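{- Let $\preccurlyeq$ be either of the non-deterministic simulation pre-orders $\preccurlyeq_i^N$ or $\preccurlyeq_m^N$. There exists a $\preccurlyeq$-universal cellular automaton, i.e. a stochastic cellular automaton $\mathcal{U}$ such that $\mathcal{A}\preccurlyeq\mathcal{U}$ for every stochastic cellular automaton $\mathcal{A}$.
   Context: A (one-dimensional) stochastic cellular automaton (CA) is a tuple $\mathcal{A}=(Q,R,V,V',f)$ where $Q$ (states) and $R$ (random symbols) are finite sets, $V=\{v_1,\dots,v_\rho\}$ and $V'=\{v'_1,\dots,v'_{\rho'}\}$ are finite subsets of $\mathbb{Z}$, and $f:Q^\rho\times R^{\rho'}\to Q$. Its explicit global function is $F:Q^{\mathbb{Z}}\times R^{\mathbb{Z}}\to Q^{\mathbb{Z}}$, $F(c,s)_z=f\big((c_{z+v_j})_j,(s_{z+v'_j})_j\big)$, with iterates $F^0(c)=c$, $F^{t+1}(c,s^1,\dots,s^{t+1})=F(F^t(c,s^1,\dots,s^t),s^{t+1})$. The non-deterministic global function is $\mathcal{N}_F(c)=\{F(c,s):s\in R^{\mathbb{Z}}\}$ for $c\in Q^{\mathbb{Z}}$. Restriction: if $i:Q'\to Q$ is injective with cell-by-cell extension $I:Q'^{\mathbb{Z}}\to Q^{\mathbb{Z}}$ and $Y=(i(Q'))^{\mathbb{Z}}$ satisfies $F(Y,R^{\mathbb{Z}})\subseteq Y$, the $i$-restriction of $\mathcal{A}$ is the stochastic CA with states $Q'$, random symbols $R$, the same neighborhoods, and explicit global function ${}_iF(c,s)=I^{ -1}(F(I(c),s))$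 for $c\in Q'^{\mathbb{Z}}$. Projection: if $\pi:Q\to Q'$ is surjective with cell-by-cell extension $\Pi$, and $\Pi(F(c,s))=\Pi(F(c',s))$ for all $s$ and all $c,c'$ with $\Pi(c)=\Pi(c')$, the $\pi$-projection of $\mathcal{A}$ is the stochastic CA with states $Q'$, random symbols $R$, the same neighborhoods, and explicit global function ${}^\pi F(c',s)=\Pi(F(c,s))$ for any $c\in\Pi^{ -1}(c')$. Local relations: $\mathcal{A}_1$ is related to $\mathcal{A}_2$ by the injection relation (resp. mixed relation) if some $i$-restriction of $\mathcal{A}_2$ (resp. some $\pi$-projection of some $i$-restriction of $\mathcal{A}_2$), with explicit global function $G$, satisfies $\mathcal{N}_{F_1}=\mathcal{N}_G$ (in particular it has the same state set as $\mathcal{A}_1$). Rescaling: for $m,t\ge1$, $z\in\mathbb{Z}$, let $b_m:S^{\mathbb{Z}}\to(S^m)^{\mathbb{Z}}$, $b_m(c)_x=(c_{mx},\dots,c_{mx+m-1})$, and $\sigma_z(c)_x=c_{x+z}$. The rescaling $\mathcal{A}^{\langle m,t,z\rangle}$ is the stochastic CA with states $Q^m$, random symbols $(R^m)^t$, suitably modified neighborhoods, and explicit global function $(c,s)\mapsto b_m\circ\sigma_z\circ F^t(b_m^{ -1}(c),b_m^{ -1}(s^1),\dots,b_m^{ -1}(s^t))$, where $s^1,\dots,s^t\in(R^m)^{\mathbb{Z}}$ are the $t$ components of $s$. Simulation: $\mathcal{A}_1\preccurlyeq\mathcal{A}_2$ iff there exist $m_1,m_2,t_1,t_2\ge1$ and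 $z_1,z_2\in\mathbb{Z}$ such that $\mathcal{A}_1^{\langle m_1,t_1,z_1\rangle}$ is in the corresponding local relation to $\mathcal{A}_2^{\langle m_2,t_2,z_2\rangle}$; $\preccurlyeq_i^N$ and $\preccurlyeq_m^N$ correspond to the injection and mixed local relations respectively. -}

module Defs where

open import Data.Fin.Base using (Fin; toℕ; fromℕ; fromℕ<; inject₁)
open import Data.Integer.Base using (ℤ; +_; _+_; _*_; _/ℕ_; _%ℕ_)
open import Data.Integer.DivMod using (n%ℕd<d; a≡a%ℕn+[a/ℕn]*n)
open import Data.Integer.Properties using (+-comm; *-comm)
open import Data.List.Base using (List; length)
open import Data.List.Relation.Unary.Unique.Propositional using (Unique)
open import Data.Fin.Properties using (toℕ-fromℕ<)
open import Data.Nat.Base using (ℕ; zero; suc; NonZero)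
open import Data.Product.Base using (Σ-syntax; ∃-syntax; _×_)
open import Data.Vec.Base as Vec using (Vec; lookup; tabulate; fromList)
open import Data.Vec.Properties using (lookup∘tabulate)
open import Function.Base using (_∘_)
open import Function.Bundles using (_↔_; _⇔_)
open import Function.Definitions using (Injective; Surjective)
open import Level using (Level) renaming (suc to lsuc; _⊔_ to _⊔ₗ_)
open import Relation.Binary.PropositionalEquality
  using (_≡_; _≗_; cong; cong₂; trans; sym)

Finite : Set → Set
Finite A = ∃[ n ] (A ↔ Fin n)

-- Configurations are compared pointwise (_≗_), as function extensionality
-- is not available.
Conf : Set → Set
Conf S = ℤ → S

-- Q may be empty, but R may not: with no random symbol there would be no
-- random configuration at all, and every set N(c) would be empty.
-- A finite subset of ℤ is an enumeration v₁, …, v_ρ without repetition.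
record CA (Q R : Set) : Set where
  field
    Q-finite   : Finite Q
    R-finite   : Finite R
    R-nonempty : R
    V V′       : List ℤ
    V-unique   : Unique V
    V′-unique  : Unique V′
    f          : Vec Q (length V) → Vec R (length V′) → Q

open CA public

record StochasticCA : Set₁ where
  field
    {State Random} : Set
    ca             : CA State Random

open StochasticCA public

private variable
  ℓ : Level
  S Q Q′ Q₁ Q₂ R R₁ R₂ : Set

global : CA Q R → Conf Q → Conf R → Conf Q
global A c s z = f A (Vec.map (λ v → c (z + v)) (fromList (V A)))
                     (Vec.map (λ v → s (z + v)) (fromList (V′ A)))

-- The argument s lists the random configurations s¹, …, sᵗ in order.
iterate : CA Q R → (t : ℕ) → Conf Q → (s : Fin t → Conf R) → Conf Q
iterate A zero    c s = c
iterate A (suc t) c s = global A (iterate A t c (s ∘ inject₁)) (s (fromℕ t))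

-- d ∈N[ A ] c means that d belongs to N_F(c).
_∈N[_]_ : Conf Q → CA Q R → Conf Q → Set
_∈N[_]_ {R = R} d A c = Σ[ s ∈ Conf R ] (global A c s ≗ d)

_≡N_ : CA Q R₁ → CA Q R₂ → Set
A ≡N B = ∀ c d → (d ∈N[ A ] c) ⇔ (d ∈N[ B ] c)

-- B is the i-restriction of A: its global function is determined by commutes,
-- since i is injective. The cell-by-cell extension of i is i ∘_.
record IsRestriction (i : Q′ → Q) (A : CA Q R) (B : CA Q′ R) : Set where
  field
    injective : Injective _≡_ _≡_ i
    closed    : ∀ c s → (∀ z → ∃[ q ] (i q ≡ c z)) →
                ∀ z → ∃[ q ] (i q ≡ global A c s z)
    same-V    : V B ≡ V A
    same-V′   : V′ B ≡ V′ A
    commutes  : ∀ c s → i ∘ global B c s ≗ global A (i ∘ c) s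

-- B is the π-projection of A: its global function is determined by commutes,
-- since π is surjective.
record IsProjection (π : Q → Q′) (A : CA Q R) (B : CA Q′ R) : Set where
  field
    surjective : Surjective _≡_ _≡_ π
    compatible : ∀ s c c′ → π ∘ c ≗ π ∘ c′ →
                 π ∘ global A c s ≗ π ∘ global A c′ s
    same-V     : V B ≡ V A
    same-V′    : V′ B ≡ V′ A
    commutes   : ∀ c′ s c → π ∘ c ≗ c′ → global B c′ s ≗ π ∘ global A c s

InjectionRelated : CA Q₁ R₁ → CA Q₂ R₂ → Set
InjectionRelated {Q₁} {R₁} {Q₂} {R₂} A₁ A₂ =
  Σ[ i ∈ (Q₁ → Q₂) ] Σ[ G ∈ CA Q₁ R₂ ] (IsRestriction i A₂ G × A₁ ≡N G)

MixedRelated : CA Q₁ R₁ → CA Q₂ R₂ → Set₁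
MixedRelated {Q₁} {R₁} {Q₂} {R₂} A₁ A₂ =
  Σ[ Q ∈ Set ] Σ[ i ∈ (Q → Q₂) ] Σ[ π ∈ (Q → Q₁) ]
  Σ[ B ∈ CA Q R₂ ] Σ[ G ∈ CA Q₁ R₂ ]
    (IsRestriction i A₂ B × IsProjection π B G × A₁ ≡N G)

block : (m : ℕ) → Conf S → Conf (Vec S m)
block m c x = tabulate (λ j → c (+ m * x + + toℕ j))

unblock : (m : ℕ) .{{_ : NonZero m}} → Conf (Vec S m) → Conf S
unblock m d y = lookup (d (y /ℕ m)) (fromℕ< (n%ℕd<d y m))

unblock-block : ∀ m .{{_ : NonZero m}} (c : Conf S) → unblock m (block m c) ≗ c
unblock-block m c y =
  trans (lookup∘tabulate _ (fromℕ< (n%ℕd<d y m)))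
        (cong c (trans (cong₂ _+_ (*-comm (+ m) (y /ℕ m))
                                  (cong +_ (toℕ-fromℕ< (n%ℕd<d y m))))
                (trans (+-comm (y /ℕ m * + m) (+ (y %ℕ m)))
                       (sym (a≡a%ℕn+[a/ℕn]*n y m)))))

shift : ℤ → Conf S → Conf S
shift z c x = c (x + z)

-- B is the rescaling of A with parameters m, t, z. Its neighborhoods are
-- unspecified: only the global function it must have is prescribed.
IsRescaling : (m t : ℕ) .{{_ : NonZero m}} (z : ℤ) →
              CA Q R → CA (Vec Q m) (Vec (Vec R m) t) → Set
IsRescaling m t z A B = ∀ c s →
  global B c s ≗
  block m (shift z (iterate A t (unblock m c)
                              (λ k → unblock m (λ x → lookup (s x) k))))

LocalRelation : (ℓ : Level) → Set (lsuc Level.zero ⊔ₗ lsuc ℓ)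
LocalRelation ℓ = ∀ {Q₁ R₁ Q₂ R₂ : Set} → CA Q₁ R₁ → CA Q₂ R₂ → Set ℓ

record SimulatedBy (_⊑_ : LocalRelation ℓ) (A₁ A₂ : StochasticCA) : Set ℓ where
  field
    m₁ m₂ t₁ t₂ : ℕ
    {{m₁≢0}}    : NonZero m₁
    {{m₂≢0}}    : NonZero m₂
    {{t₁≢0}}    : NonZero t₁
    {{t₂≢0}}    : NonZero t₂
    z₁ z₂       : ℤ
    B₁          : CA (Vec (State A₁) m₁) (Vec (Vec (Random A₁) m₁) t₁)
    B₂          : CA (Vec (State A₂) m₂) (Vec (Vec (Random A₂) m₂) t₂)
    rescaling₁  : IsRescaling m₁ t₁ z₁ (ca A₁) B₁
    rescaling₂  : IsRescaling m₂ t₂ z₂ (ca A₂) B₂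
    related     : B₁ ⊑ B₂

infix 4 _≼ᵢ_ _≼ₘ_

_≼ᵢ_ : StochasticCA → StochasticCA → Set
_≼ᵢ_ = SimulatedBy InjectionRelated

_≼ₘ_ : StochasticCA → StochasticCA → Set₁
_≼ₘ_ = SimulatedBy MixedRelated

Universal : (StochasticCA → StochasticCA → Set ℓ) → StochasticCA → Set (lsuc Level.zero ⊔ₗ ℓ)
Universal _≼_ U = ∀ A → A ≼ U

{-# OPTIONS --safe #-}
module Submission where

-- One automaton, universal, whose states are the type Cell and whose random
-- symbols are bits, simulates every stochastic cellular automaton A, already for
-- the injection relation; with the identity as projection, this is also a
-- simulation for the mixed relation (injection⇒mixed).
--
-- A cell of A is represented by a block of K segments of G cells each. The first
-- cell of a segment holds two data bits, stored and output, and the G cells of the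
-- j-th segment hold the j-th column of a program of G rows, a row being a vector of
-- K instructions. Every block has one head, which carries a Boolean flag. All
-- heads move right by one cell per step, so a sweep of K * G steps brings each
-- head from the start of a block to the start of the next one. On the first cell
-- of a segment the head executes the instruction found there on its flag and on the
-- two data bits; on its way through the segment it rotates the instructions
-- by one place. Hence a sweep executes the first row of the program and moves that
-- row to the end (execute-row), and after G sweeps the program is back in place
-- whatever the random bits were (execute). For this reason encoded configurations
-- are mapped to encoded configurations.
--
-- The program for A starts by drawing random bits in every block, which encode the
-- random symbol of the corresponding cell of A. Let L bound the neighborhoods of
-- A. For every window e of 2L+1 cells of A (states and random bits), 2L+1 rows
-- compare e with the 2L+1 blocks that a head crosses in as many sweeps, the flag
-- recording whether all of them agree. One more row then writes the state that the
-- local rule assigns to e into the output bits of the block reached by the head, if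
-- the flag is true, and another one sets the flags again. Since all windows are
-- listed, each block finally outputs the new state of the cell represented L+1 blocks
-- to its left (run-table, final-stored). The last row moves it to the stored
-- bits; the displacement by L+1 blocks is compensated by the shift of the rescaling.
-- As a random symbol is drawn once, before the comparisons, it is shared correctly by
-- all the cells that depend on it.
--
-- Every random configuration of A is decoded from some random configuration of
-- universal (noiseBits-noiseFor), so the two non-deterministic global functions are
-- equal. Two general facts supply the automata themselves: every rescaling
-- is the global function of a cellular automaton (rescale-isRescaling), and so is
-- every map that an automaton computes on encoded configurations
-- (restriction-isRestriction).

open import Defs
open import Data.Bool.Base using (Bool; true; false; not; _∧_; if_then_else_)
import Data.Bool.Properties as Boolₚ
open import Data.Fin.Base as Fin using (Fin; toℕ; fromℕ; fromℕ<; inject₁)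
open import Data.Fin.Patterns using (0F; 1F; 2F; 3F; 4F; 5F; 6F)
open import Data.Fin.Properties
  using (*↔×; 2↔Bool; toℕ<n; toℕ-fromℕ<; toℕ-fromℕ; toℕ-inject₁)
open import Data.Integer.Base as ℤ
  using (ℤ; +_; -[1+_]; 0ℤ; 1ℤ; -1ℤ; _+_; _*_; _/ℕ_; _%ℕ_; ∣_∣; -_)
open import Data.Integer.DivMod using (n%ℕd<d; a≡a%ℕn+[a/ℕn]*n; [n/ℕd]*d≤n; n<s[n/ℕd]*d)
import Data.Integer.Properties as ℤₚ
open import Data.Integer.Tactic.RingSolver using (solve-∀)
open import Data.List.Base as List using (List; []; _∷_; _∷ʳ_; length; deduplicate; concatMap)
open import Data.List.Membership.Propositional using (_∈_)
open import Data.List.Membership.Propositional.Properties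
  using (∈-deduplicate⁺; ∈-++⁺ˡ; ∈-++⁺ʳ; ∈-map⁺; ∈-concatMap⁺; ∈-allFin)
import Data.List.Properties as Listₚ
open import Data.List.Relation.Unary.All using ([]; _∷_)
open import Data.List.Relation.Unary.AllPairs using ([]; _∷_)
open import Data.List.Relation.Unary.Any as Any using (here; there)
open import Data.List.Relation.Unary.Unique.DecPropositional.Properties ℤₚ._≟_
  using (deduplicate-!)
open import Data.Maybe.Base as Maybe using (Maybe; just; nothing; maybe)
open import Data.Nat.Base as ℕ using (ℕ; zero; suc; NonZero)
import Data.Nat.DivMod as ℕ
import Data.Nat.Properties as ℕₚ
open import Data.Product.Base using (∃-syntax; _×_; _,_; proj₁; proj₂; uncurry)
open import Data.Product.Function.NonDependent.Propositional using (_×-cong_)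
open import Data.Sum.Base using (_⊎_; inj₁; inj₂)
open import Data.Vec.Base as Vec using (Vec; []; _∷_; lookup; tabulate; fromList)
import Data.Vec.Properties as Vecₚ
open import Function.Base using (_∘_; id)
open import Function.Bundles using (mk⇔; mk↔ₛ′; module Inverse)
open import Function.Definitions using (Injective)
open import Function.Properties.Inverse using (↔-trans; ↔-sym)
open import Relation.Binary.PropositionalEquality
open import Relation.Nullary using (yes; no; contradiction)

open import Algebra.Properties.AbelianGroup ℤₚ.+-0-abelianGroup using (∙-cancelˡ)
open ≡-Reasoning

private variable
  S Q Q′ R R′ X Y : Set
  n : ℕ

-- Finite sets

Finite-× : Finite X → Finite Y → Finite (X × Y)
Finite-× (m , f) (n , g) = m ℕ.* n , ↔-trans (f ×-cong g) (↔-sym *↔×)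

Finite-Vec : Finite X → ∀ n → Finite (Vec X n)
Finite-Vec F zero    =
  1 , mk↔ₛ′ (λ _ → 0F) (λ _ → []) (λ { 0F → refl ; (Fin.suc ()) }) (λ { [] → refl })
Finite-Vec F (suc n) with k , f ← Finite-× F (Finite-Vec F n) =
  k , ↔-trans (mk↔ₛ′ (λ { (x ∷ xs) → x , xs }) (uncurry _∷_) (λ _ → refl) (λ { (x ∷ xs) → refl })) f

elements : Finite X → List X
elements (n , f) = List.map (Inverse.from f) (List.allFin n)

∈-elements : (F : Finite X) → ∀ x → x ∈ elements F
∈-elements F@(n , f) x =
  subst (_∈ elements F) (Inverse.strictlyInverseʳ f x) (∈-map⁺ (Inverse.from f) (∈-allFin (Inverse.to f x)))

-- Division of ℤ into blocks

-- The cell i of the block b.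
pos : ℕ → ℤ → ℕ → ℤ
pos m b i = + m * b + + i

quotient-≤ : ∀ m .{{_ : NonZero m}} q q′ y →
             q * + m ℤ.≤ y → y ℤ.< ℤ.suc q′ * + m → q ℤ.≤ q′
quotient-≤ m@(suc _) q q′ y lo hi =
  subst (q ℤ.≤_) (ℤₚ.pred-suc q′)
    (ℤₚ.i<j⇒i≤pred[j] (ℤₚ.*-cancelʳ-<-nonNeg {j = ℤ.suc q′} (+ m) (ℤₚ.≤-<-trans lo hi)))

pos-/ℕ : ∀ m .{{_ : NonZero m}} b {i} → i ℕ.< m → pos m b i /ℕ m ≡ b
pos-/ℕ m b {i} i<m = ℤₚ.≤-antisym
  (quotient-≤ m _ b y ([n/ℕd]*d≤n y m)
    (subst (y ℤ.<_) (eq (+ m) b) (ℤₚ.+-monoʳ-< (+ m * b) (ℤ.+<+ i<m))))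
  (quotient-≤ m b _ y
    (subst (ℤ._≤ y) (ℤₚ.*-comm (+ m) b) (ℤₚ.i≤i+j (+ m * b) (+ i)))
    (n<s[n/ℕd]*d y m))
  where
  y = pos m b i
  eq : ∀ m b → m * b + m ≡ (1ℤ + b) * m
  eq = solve-∀

pos-%ℕ : ∀ m .{{_ : NonZero m}} b {i} → i ℕ.< m → pos m b i %ℕ m ≡ i
pos-%ℕ m b {i} i<m = ℤₚ.+-injective (∙-cancelˡ (+ m * b) _ _ (begin
  + m * b + + (y %ℕ m)          ≡⟨ cong (λ q → + m * q + + (y %ℕ m)) (pos-/ℕ m b i<m) ⟨
  + m * (y /ℕ m) + + (y %ℕ m)   ≡⟨ eq (+ m) (y /ℕ m) (+ (y %ℕ m)) ⟩
  + (y %ℕ m) + (y /ℕ m) * + m   ≡⟨ a≡a%ℕn+[a/ℕn]*n y m ⟨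
  y                             ∎))
  where
  y = pos m b i
  eq : ∀ m q r → m * q + r ≡ r + q * m
  eq = solve-∀

pos-divmod : ∀ m .{{_ : NonZero m}} y → y ≡ pos m (y /ℕ m) (y %ℕ m)
pos-divmod m y = trans (a≡a%ℕn+[a/ℕn]*n y m) (eq (+ m) (y /ℕ m) (+ (y %ℕ m)))
  where
  eq : ∀ m q r → r + q * m ≡ m * q + r
  eq = solve-∀

unblock-pos : ∀ m .{{_ : NonZero m}} (d : Conf (Vec X m)) b {i} (i<m : i ℕ.< m) →
              unblock m d (pos m b i) ≡ lookup (d b) (fromℕ< i<m)
unblock-pos m d b i<m =
  lookup-cong (cong d (pos-/ℕ m b i<m)) (n%ℕd<d (pos m b _) m) i<m (pos-%ℕ m b i<m)
  where
  lookup-cong : ∀ {n} {u v : Vec X n} {i j} → u ≡ v → (p : i ℕ.< n) (q : j ℕ.< n) → i ≡ j →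
                lookup u (fromℕ< p) ≡ lookup v (fromℕ< q)
  lookup-cong refl p q refl = refl

-- A translation by a multiple of m is a translation of blocks.
unblock-translate : ∀ m .{{_ : NonZero m}} (d d′ : Conf (Vec X m)) x x′ w →
  d (x + w /ℕ m) ≡ d′ (x′ + w /ℕ m) → unblock m d (+ m * x + w) ≡ unblock m d′ (+ m * x′ + w)
unblock-translate m d d′ x x′ w eq = begin
  unblock m d (+ m * x + w)                  ≡⟨ cong (unblock m d) (split x) ⟩
  unblock m d (pos m (x + w /ℕ m) (w %ℕ m))  ≡⟨ unblock-pos m d _ r<m ⟩
  lookup (d (x + w /ℕ m)) (fromℕ< r<m)       ≡⟨ cong (λ v → lookup v (fromℕ< r<m)) eq ⟩
  lookup (d′ (x′ + w /ℕ m)) (fromℕ< r<m)     ≡⟨ unblock-pos m d′ _ r<m ⟨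
  unblock m d′ (pos m (x′ + w /ℕ m) (w %ℕ m)) ≡⟨ cong (unblock m d′) (split x′) ⟨
  unblock m d′ (+ m * x′ + w)                ∎
  where
  r<m = n%ℕd<d w m
  eq′ : ∀ m x q r → m * x + (m * q + r) ≡ m * (x + q) + r
  eq′ = solve-∀
  split : ∀ x → + m * x + w ≡ pos m (x + w /ℕ m) (w %ℕ m)
  split x = trans (cong (λ y → + m * x + y) (pos-divmod m w)) (eq′ (+ m) x (w /ℕ m) (+ (w %ℕ m)))

-- Locality

map-fromList-cong : ∀ (xs : List X) {f g : X → Y} → (∀ {x} → x ∈ xs → f x ≡ g x) →
                    Vec.map f (fromList xs) ≡ Vec.map g (fromList xs)
map-fromList-cong []       eq = refl
map-fromList-cong (x ∷ xs) eq = cong₂ _∷_ (eq (here refl)) (map-fromList-cong xs (eq ∘ there))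

-- Locality and translation invariance of the global function, in one statement.
global-local : ∀ (A : CA Q R) c c′ s s′ z z′ →
  (∀ {v} → v ∈ V A  → c (z + v) ≡ c′ (z′ + v)) →
  (∀ {v} → v ∈ V′ A → s (z + v) ≡ s′ (z′ + v)) →
  global A c s z ≡ global A c′ s′ z′
global-local A c c′ s s′ z z′ eqc eqs =
  cong₂ (f A) (map-fromList-cong (V A) eqc) (map-fromList-cong (V′ A) eqs)

global-cong : ∀ (A : CA Q R) {c c′ : Conf Q} {s s′ : Conf R} →
              c ≗ c′ → s ≗ s′ → global A c s ≗ global A c′ s′
global-cong A {c} {c′} {s} {s′} eqc eqs z =
  global-local A c c′ s s′ z z (λ {v} _ → eqc (z + v)) (λ {v} _ → eqs (z + v))

-- Offsets of the cells, deterministic or random, that can influence t steps of A.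
dependencies : CA Q R → ℕ → List ℤ
dependencies A zero    = 0ℤ ∷ []
dependencies A (suc t) = V′ A List.++ concatMap (λ v → List.map (λ d → v + d) (dependencies A t)) (V A)

-- Locality and translation invariance of the iterates.
iterate-local : ∀ (A : CA Q R) t c c′ (s s′ : Fin t → Conf R) y y′ →
  (∀ {d} → d ∈ dependencies A t → c (y + d) ≡ c′ (y′ + d)) →
  (∀ k {d} → d ∈ dependencies A t → s k (y + d) ≡ s′ k (y′ + d)) →
  iterate A t c s y ≡ iterate A t c′ s′ y′
iterate-local A zero c c′ s s′ y y′ eqc eqs = begin
  c y           ≡⟨ cong c (ℤₚ.+-identityʳ y) ⟨
  c (y + 0ℤ)    ≡⟨ eqc (here refl) ⟩
  c′ (y′ + 0ℤ)  ≡⟨ cong c′ (ℤₚ.+-identityʳ y′) ⟩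
  c′ y′         ∎
iterate-local A (suc t) c c′ s s′ y y′ eqc eqs = global-local A
  (iterate A t c (s ∘ inject₁)) (iterate A t c′ (s′ ∘ inject₁)) (s (fromℕ t)) (s′ (fromℕ t)) y y′
  (λ {v} v∈V → iterate-local A t c c′ (s ∘ inject₁) (s′ ∘ inject₁) (y + v) (y′ + v)
    (λ {d} d∈ → reassoc c c′ v d (eqc (step v∈V d∈)))
    (λ k {d} d∈ → reassoc (s (inject₁ k)) (s′ (inject₁ k)) v d (eqs (inject₁ k) (step v∈V d∈))))
  (λ v∈V′ → eqs (fromℕ t) (∈-++⁺ˡ v∈V′))
  where
  step : ∀ {v d} → v ∈ V A → d ∈ dependencies A t → v + d ∈ dependencies A (suc t)
  step {v} {d} v∈V d∈ = ∈-++⁺ʳ (V′ A) (∈-concatMap⁺ (λ v → List.map (λ d → v + d) (dependencies A t))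
    (Any.map (λ { refl → ∈-map⁺ (λ d → v + d) d∈ }) v∈V))
  reassoc : ∀ {X : Set} (g g′ : Conf X) v d →
            g (y + (v + d)) ≡ g′ (y′ + (v + d)) → g (y + v + d) ≡ g′ (y′ + v + d)
  reassoc g g′ v d eq =
    trans (cong g (ℤₚ.+-assoc y v d)) (trans eq (cong g′ (sym (ℤₚ.+-assoc y′ v d))))

-- The configuration with the given values on the cells of a neighborhood and
-- the default x₀ elsewhere.
extend : (vs : List ℤ) → X → Vec X (length vs) → Conf X
extend []       x₀ []       z = x₀
extend (v ∷ vs) x₀ (x ∷ xs) z with z ℤₚ.≟ v
... | yes _ = x
... | no  _ = extend vs x₀ xs z

extend-map : ∀ (g : Conf X) vs x₀ {v} → v ∈ vs → extend vs x₀ (Vec.map g (fromList vs)) v ≡ g v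
extend-map g (u ∷ vs) x₀ {v} v∈ with v ℤₚ.≟ u
... | yes refl = refl
extend-map g (u ∷ vs) x₀ (here v≡u) | no v≢u = contradiction v≡u v≢u
extend-map g (u ∷ vs) x₀ (there v∈) | no v≢u = extend-map g vs x₀ v∈

-- An extension of the local view at z agrees with the configuration around z.
extend-view : ∀ (g : Conf X) vs x₀ z {v} → v ∈ vs →
              extend vs x₀ (Vec.map (λ v → g (z + v)) (fromList vs)) (0ℤ + v) ≡ g (z + v)
extend-view g vs x₀ z {v} v∈ =
  trans (cong (extend vs x₀ _) (ℤₚ.+-identityˡ v)) (extend-map (λ v → g (z + v)) vs x₀ v∈)

-- Existence of rescalings

-- Offsets of the blocks that can influence a cell of a block in t steps.
blockOffsets : CA Q R → (m t : ℕ) .{{_ : NonZero m}} → ℤ → List ℤ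
blockOffsets A m t z =
  concatMap (λ j → List.map (λ d → (+ toℕ j + z + d) /ℕ m) (dependencies A t)) (List.allFin m)

-- The neighborhood of the rescaled automaton. It contains 0, so that a local view
-- is never empty: its first entry can be used as a default value.
neighborhood : CA Q R → (m t : ℕ) .{{_ : NonZero m}} → ℤ → List ℤ
neighborhood A m t z = deduplicate ℤₚ._≟_ (0ℤ ∷ blockOffsets A m t z)

∈-neighborhood : ∀ (A : CA Q R) m t .{{_ : NonZero m}} z j {d} → d ∈ dependencies A t →
                 (+ toℕ j + z + d) /ℕ m ∈ neighborhood A m t z
∈-neighborhood A m t z j {d} d∈ = ∈-deduplicate⁺ ℤₚ._≟_ {xs = 0ℤ ∷ blockOffsets A m t z} (there
  (∈-concatMap⁺ (λ (j : Fin m) → List.map (λ d → (+ toℕ j + z + d) /ℕ m) (dependencies A t))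
    {xs = List.allFin m}
    (Any.map (λ { refl → ∈-map⁺ (λ d → (+ toℕ j + z + d) /ℕ m) d∈ }) (∈-allFin j))))

-- The global function required of a rescaling.
rescaledGlobal : CA Q R → (m t : ℕ) .{{_ : NonZero m}} → ℤ →
                 Conf (Vec Q m) → Conf (Vec (Vec R m) t) → Conf (Vec Q m)
rescaledGlobal A m t z c s =
  block m (shift z (iterate A t (unblock m c) (λ k → unblock m (λ x → lookup (s x) k))))

rescaledGlobal-local : ∀ (A : CA Q R) m t .{{_ : NonZero m}} z c c′ s s′ x x′ →
  (∀ {v} → v ∈ neighborhood A m t z → c (x + v) ≡ c′ (x′ + v)) →
  (∀ {v} → v ∈ neighborhood A m t z → s (x + v) ≡ s′ (x′ + v)) →
  rescaledGlobal A m t z c s x ≡ rescaledGlobal A m t z c′ s′ x′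
rescaledGlobal-local A m t z c c′ s s′ x x′ eqc eqs = Vecₚ.tabulate-cong λ j →
  iterate-local A t (unblock m c) (unblock m c′)
    (λ k → unblock m (λ x → lookup (s x) k)) (λ k → unblock m (λ x → lookup (s′ x) k))
    (+ m * x + + toℕ j + z) (+ m * x′ + + toℕ j + z)
    (λ d∈ → translate c c′ j _ (eqc (∈-neighborhood A m t z j d∈)))
    (λ k d∈ → translate (λ y → lookup (s y) k) (λ y → lookup (s′ y) k) j _
                (cong (λ u → lookup u k) (eqs (∈-neighborhood A m t z j d∈))))
  where
  eq : ∀ a j z d → a + (j + z + d) ≡ a + j + z + d
  eq = solve-∀
  translate : ∀ {X : Set} (g g′ : Conf (Vec X m)) (j : Fin m) d →
    g (x + (+ toℕ j + z + d) /ℕ m) ≡ g′ (x′ + (+ toℕ j + z + d) /ℕ m) →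
    unblock m g (+ m * x + + toℕ j + z + d) ≡ unblock m g′ (+ m * x′ + + toℕ j + z + d)
  translate g g′ j d e = begin
    unblock m g (+ m * x + + toℕ j + z + d)     ≡⟨ cong (unblock m g) (eq (+ m * x) (+ toℕ j) z d) ⟨
    unblock m g (+ m * x + (+ toℕ j + z + d))   ≡⟨ unblock-translate m g g′ x x′ _ e ⟩
    unblock m g′ (+ m * x′ + (+ toℕ j + z + d)) ≡⟨ cong (unblock m g′) (eq (+ m * x′) (+ toℕ j) z d) ⟩
    unblock m g′ (+ m * x′ + + toℕ j + z + d)   ∎

-- The local rule evaluates the rescaled global function at 0, on an extension of
-- the local view; by locality the choice of the extension is irrelevant.
rescale : CA Q R → (m t : ℕ) .{{_ : NonZero m}} → ℤ → CA (Vec Q m) (Vec (Vec R m) t)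
rescale A m t z = record
  { Q-finite   = Finite-Vec (Q-finite A) m
  ; R-finite   = Finite-Vec (Finite-Vec (R-finite A) m) t
  ; R-nonempty = Vec.replicate t (Vec.replicate m (R-nonempty A))
  ; V          = neighborhood A m t z
  ; V′         = neighborhood A m t z
  ; V-unique   = deduplicate-! (0ℤ ∷ blockOffsets A m t z)
  ; V′-unique  = deduplicate-! (0ℤ ∷ blockOffsets A m t z)
  ; f          = λ u w → rescaledGlobal A m t z (extend (neighborhood A m t z) (Vec.head u) u)
                                                (extend (neighborhood A m t z) (Vec.head w) w) 0ℤ
  }

rescale-isRescaling : ∀ (A : CA Q R) m t .{{_ : NonZero m}} z → IsRescaling m t z A (rescale A m t z)
rescale-isRescaling A m t z c s x =
  rescaledGlobal-local A m t z
    (extend N (c (x + 0ℤ)) (Vec.map (λ v → c (x + v)) (fromList N))) c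
    (extend N (s (x + 0ℤ)) (Vec.map (λ v → s (x + v)) (fromList N))) s 0ℤ x
    (extend-view c N (c (x + 0ℤ)) x) (extend-view s N (s (x + 0ℤ)) x)
  where
  N = neighborhood A m t z

-- Restrictions

-- A map Φ that B computes on configurations encoded by i is the global function of
-- an i-restriction of B. Its local rule evaluates Φ at 0 on an extension of the local
-- view; q₀ supplies the state needed outside the view, since Q may be empty.
module _ (B : CA S R) (Q-fin : Finite Q) (q₀ : Vec Q (length (V B)) → Q)
  (i : Q → S) (Φ : Conf Q → Conf R → Conf Q) where

  restriction : CA Q R
  restriction = record
    { Q-finite   = Q-fin
    ; R-finite   = R-finite B
    ; R-nonempty = R-nonempty B
    ; V          = V B
    ; V′         = V′ B
    ; V-unique   = V-unique B
    ; V′-unique  = V′-unique B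
    ; f          = λ u w → Φ (extend (V B) (q₀ u) u) (extend (V′ B) (R-nonempty B) w) 0ℤ
    }

  module _ (i-injective : Injective _≡_ _≡_ i)
           (i-commutes : ∀ c s → i ∘ Φ c s ≗ global B (i ∘ c) s) where

    restriction-commutes : ∀ c s → i ∘ global restriction c s ≗ global B (i ∘ c) s
    restriction-commutes c s z = trans (i-commutes c̃ s̃ 0ℤ)
      (global-local B (i ∘ c̃) (i ∘ c) s̃ s 0ℤ z
        (λ v∈ → cong i (extend-view c (V B) _ z v∈)) (extend-view s (V′ B) _ z))
      where
      view = Vec.map (λ v → c (z + v)) (fromList (V B))
      c̃ = extend (V B) (q₀ view) view
      s̃ = extend (V′ B) (R-nonempty B) (Vec.map (λ v → s (z + v)) (fromList (V′ B)))

    restriction-global : ∀ c s → global restriction c s ≗ Φ c s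
    restriction-global c s z = i-injective (trans (restriction-commutes c s z) (sym (i-commutes c s z)))

    restriction-isRestriction : IsRestriction i B restriction
    restriction-isRestriction = record
      { injective = i-injective
      ; closed    = λ c s dec z → Φ (proj₁ ∘ dec) s z ,
                      trans (i-commutes (proj₁ ∘ dec) s z)
                        (global-cong B {i ∘ proj₁ ∘ dec} {c} {s} (proj₂ ∘ dec) (λ _ → refl) z)
      ; same-V    = refl
      ; same-V′   = refl
      ; commutes  = restriction-commutes
      }

injection⇒mixed : (A₁ : CA Q R) (A₂ : CA Q′ R′) → InjectionRelated A₁ A₂ → MixedRelated A₁ A₂
injection⇒mixed {Q = Q} A₁ A₂ (i , G , restr , eq) = Q , i , id , G , G , restr , projection , eq
  where
  projection : IsProjection id G G
  projection = record
    { surjective = λ q → q , id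
    ; compatible = λ s c c′ eq → global-cong G {c} {c′} {s} eq (λ _ → refl)
    ; same-V     = refl
    ; same-V′    = refl
    ; commutes   = λ c′ s c eq z → sym (global-cong G {c} {c′} {s} eq (λ _ → refl) z)
    }

≼ᵢ⇒≼ₘ : ∀ {A₁ A₂} → A₁ ≼ᵢ A₂ → A₁ ≼ₘ A₂
≼ᵢ⇒≼ₘ sim = record
  { m₁ = m₁ ; m₂ = m₂ ; t₁ = t₁ ; t₂ = t₂ ; z₁ = z₁ ; z₂ = z₂ ; B₁ = B₁ ; B₂ = B₂
  ; rescaling₁ = rescaling₁ ; rescaling₂ = rescaling₂ ; related = injection⇒mixed B₁ B₂ related }
  where open SimulatedBy sim

-- Iteration along an infinite sequence of random configurations

run : CA Q R → Conf Q → (ℕ → Conf R) → ℕ → Conf Q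
run A c σ zero    = c
run A c σ (suc t) = global A (run A c σ t) (σ t)

run-+ : ∀ (A : CA Q R) c σ a b → run A c σ (a ℕ.+ b) ≡ run A (run A c σ a) (λ k → σ (a ℕ.+ k)) b
run-+ A c σ a zero    = cong (run A c σ) (ℕₚ.+-identityʳ a)
run-+ A c σ a (suc b) = trans (cong (run A c σ) (ℕₚ.+-suc a b))
  (cong (λ d → global A d (σ (a ℕ.+ b))) (run-+ A c σ a b))

iterate≗run : ∀ (A : CA Q R) t c s σ → (∀ k → s k ≗ σ (toℕ k)) → iterate A t c s ≗ run A c σ t
iterate≗run A zero    c s σ eq z = refl
iterate≗run A (suc t) c s σ eq = global-cong A
  (iterate≗run A t c (s ∘ inject₁) σ
    (λ k z → trans (eq (inject₁ k) z) (cong (λ n → σ n z) (toℕ-inject₁ k))))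
  (λ z → trans (eq (fromℕ t) z) (cong (λ n → σ n z) (toℕ-fromℕ t)))

-- The universal automaton

-- Instructions, executed by a head with flag r on data bits s (stored) and o
-- (output): check b replaces r by its conjunction with s = b, put b sets o to b if r
-- is true, reset makes r true, sample draws s at random, and commit moves o to s.
data Instr : Set where
  check put           : Bool → Instr
  reset sample commit : Instr

-- The role of a cell in its segment. Only a first cell has data bits; a segment of
-- more than one cell ends with a last one.
data Kind : Set where
  first       : (s o : Bool) → Kind
  middle last : Kind

-- The second component of a head is the instruction picked up at the first cell of
-- a segment, to be dropped at its last cell; between segments it is the instruction reset.
Tape Head Cell : Set
Tape = Instr × Kind
Head = Bool × Instr
Cell = Maybe Head × Tape

-- The flag and the two data bits after an instruction. The arguments are the flag r
-- or the random bit ρ, followed by data bits.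
nextR : Instr → Bool → Bool → Bool
nextR (check true)  r s = r ∧ s
nextR (check false) r s = r ∧ not s
nextR (put _)       r s = r
nextR reset         r s = true
nextR sample        r s = r
nextR commit        r s = r

nextS : Instr → Bool → Bool → Bool → Bool
nextS (check _) ρ s o = s
nextS (put _)   ρ s o = s
nextS reset     ρ s o = s
nextS sample    ρ s o = ρ
nextS commit    ρ s o = o

nextO : Instr → Bool → Bool → Bool
nextO (check _) r o = o
nextO (put b)   r o = if r then b else o
nextO reset     r o = o
nextO sample    r o = o
nextO commit    r o = false

-- The head after it has passed over a cell.
advance : Head → Tape → Head
advance (r , c) (i , first s o) = nextR i r s , i
advance (r , c) (i , middle)    = r , c
advance (r , c) (i , last)      = r , reset

-- The tape left behind by a head, where n is the instruction of the right
-- neighbour: instructions move left within the segment, and the one that was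
-- first, carried by the head, becomes the last.
write : Bool → Head → Tape → Instr → Tape
write ρ (r , c) (i , first s o) n = n , first (nextS i ρ s o) (nextO i r o)
write ρ (r , c) (i , middle)    n = n , middle
write ρ (r , c) (i , last)      n = c , last

moveHead : (left : Cell) → Maybe Head
moveHead (h , t) = Maybe.map (λ h → advance h t) h

moveTape : (centre right : Cell) → Bool → Tape
moveTape (h , t) (_ , n , _) ρ = maybe (λ h → write ρ h t n) t h

rule : (left centre right : Cell) → Bool → Cell
rule l c r ρ = moveHead l , moveTape c r ρ

Finite-Bool : Finite Bool
Finite-Bool = 2 , ↔-sym 2↔Bool

Finite-Instr : Finite Instr
Finite-Instr = 7 , mk↔ₛ′
  (λ { (check false) → 0F ; (check true) → 1F ; (put false) → 2F ; (put true) → 3F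
     ; reset → 4F ; sample → 5F ; commit → 6F })
  (λ { 0F → check false ; 1F → check true ; 2F → put false ; 3F → put true
     ; 4F → reset ; 5F → sample ; 6F → commit })
  (λ { 0F → refl ; 1F → refl ; 2F → refl ; 3F → refl ; 4F → refl ; 5F → refl ; 6F → refl })
  (λ { (check false) → refl ; (check true) → refl ; (put false) → refl ; (put true) → refl
     ; reset → refl ; sample → refl ; commit → refl })

Finite-Kind : Finite Kind
Finite-Kind = 6 , mk↔ₛ′
  (λ { (first false false) → 0F ; (first false true) → 1F ; (first true false) → 2F
     ; (first true true) → 3F ; middle → 4F ; last → 5F })
  (λ { 0F → first false false ; 1F → first false true ; 2F → first true false
     ; 3F → first true true ; 4F → middle ; 5F → last })
  (λ { 0F → refl ; 1F → refl ; 2F → refl ; 3F → refl ; 4F → refl ; 5F → refl })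
  (λ { (first false false) → refl ; (first false true) → refl ; (first true false) → refl
     ; (first true true) → refl ; middle → refl ; last → refl })

Finite-Maybe : Finite X → Finite (Maybe X)
Finite-Maybe (n , f) = suc n , mk↔ₛ′
  (maybe (Fin.suc ∘ Inverse.to f) Fin.zero)
  (λ { Fin.zero → nothing ; (Fin.suc k) → just (Inverse.from f k) })
  (λ { Fin.zero → refl ; (Fin.suc k) → cong Fin.suc (Inverse.strictlyInverseˡ f k) })
  (λ { nothing → refl ; (just x) → cong just (Inverse.strictlyInverseʳ f x) })

universal : CA Cell Bool
universal = record
  { Q-finite   = Finite-× (Finite-Maybe (Finite-× Finite-Bool Finite-Instr))
                          (Finite-× Finite-Instr Finite-Kind)
  ; R-finite   = Finite-Bool
  ; R-nonempty = true
  ; V          = -1ℤ ∷ 0ℤ ∷ 1ℤ ∷ []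
  ; V′         = 0ℤ ∷ []
  ; V-unique   = ((λ ()) ∷ (λ ()) ∷ []) ∷ ((λ ()) ∷ []) ∷ [] ∷ []
  ; V′-unique  = [] ∷ []
  ; f          = λ { (l ∷ c ∷ r ∷ []) (ρ ∷ []) → rule l c r ρ }
  }

-- The local rule, with equality proofs to name the neighbours freely.
global-universal : ∀ (c : Conf Cell) s {x y z} → x + -1ℤ ≡ y → x + 1ℤ ≡ z →
                   global universal c s x ≡ rule (c y) (c x) (c z) (s x)
global-universal c s {x} refl refl =
  cong₂ (λ u v → rule (c (x + -1ℤ)) (c u) (c (x + 1ℤ)) (s v)) (ℤₚ.+-identityʳ x) (ℤₚ.+-identityʳ x)

-- One sweep of the heads

-- The head that enters the block T as h, on arrival at the cell i.
headAt : Head → (ℕ → Tape) → ℕ → Head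
headAt h T zero    = h
headAt h T (suc i) = advance (headAt h T i) (T i)

-- The tape of the cell i after the passage of that head.
swept : (ℕ → Bool) → Head → (ℕ → Tape) → ℕ → Tape
swept ρ h T i = write (ρ i) (headAt h T i) (T i) (proj₁ (T (suc i)))

-- The possible states of the cell i of a block when its head is on the cell j.
data Stage (ρ : ℕ → Bool) (h : Head) (T : ℕ → Tape) (j i : ℕ) : Cell → Set where
  passed  : i ℕ.< j → Stage ρ h T j i (nothing , swept ρ h T i)
  reached : i ≡ j   → Stage ρ h T j i (just (headAt h T i) , T i)
  ahead   : j ℕ.< i → Stage ρ h T j i (nothing , T i)

-- With the state r of the right neighbour, a head writes on the cell i what it would
-- write if the tape of the neighbour were still T (suc i).
Lookahead : (ℕ → Tape) → ℕ → Cell → Set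
Lookahead T i r = ∀ ρ h → write ρ h (T i) (proj₁ (proj₂ r)) ≡ write ρ h (T i) (proj₁ (T (suc i)))

-- The random bit x and the right neighbour r matter only where the head is.
stage-step : ∀ {ρ h T j i l c x} r → Stage ρ h T j i l → Stage ρ h T j (suc i) c →
  (suc i ≡ j → x ≡ ρ (suc i)) → (suc i ≡ j → Lookahead T (suc i) r) →
  Stage ρ h T (suc j) (suc i) (rule l c r x)
stage-step r (passed _) (passed si<j) rnd look = passed (ℕₚ.m<n⇒m<1+n si<j)
stage-step {ρ} {h} {T} {i = i} r (passed _) (reached refl) rnd look
  rewrite rnd refl | look refl (ρ (suc i)) (headAt h T (suc i)) = passed (ℕₚ.n<1+n _)
stage-step r (passed i<j)   (ahead j<si)   rnd look =
  contradiction (ℕₚ.<-≤-trans i<j (ℕ.s≤s⁻¹ j<si)) (ℕₚ.<-irrefl refl)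
stage-step r (reached refl) (passed si<j)  rnd look = contradiction si<j (ℕₚ.<-asym (ℕₚ.n<1+n _))
stage-step r (reached refl) (ahead _)      rnd look = reached refl
stage-step r (ahead j<i)    (passed si<j)  rnd look =
  contradiction (ℕₚ.<-trans j<i (ℕₚ.n<1+n _)) (ℕₚ.<-asym si<j)
stage-step r (ahead j<i)    (reached refl) rnd look = contradiction j<i (ℕₚ.<-asym (ℕₚ.n<1+n _))
stage-step r (ahead j<i)    (ahead _)      rnd look = ahead (ℕ.s≤s j<i)

tape-step : ∀ {ρ h T j i} c r {x} → Stage ρ h T j i c → i ℕ.≤ j →
  (i ≡ j → x ≡ ρ i) → (i ≡ j → Lookahead T i r) →
  moveTape c r x ≡ swept ρ h T i
tape-step c r (passed _) i≤j rnd look = refl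
tape-step {ρ} {h} {T} {i = i} c r (reached refl) i≤j rnd look
  rewrite rnd refl = look refl (ρ i) (headAt h T i)
tape-step c r (ahead j<i) i≤j rnd look = contradiction (ℕₚ.<-≤-trans j<i i≤j) (ℕₚ.<-irrefl refl)

head-none : ∀ {ρ h T j i l} → Stage ρ h T j i l → i ≢ j → moveHead l ≡ nothing
head-none (passed _)  i≢j = refl
head-none (reached p) i≢j = contradiction p i≢j
head-none (ahead _)   i≢j = refl

head-moves : ∀ {ρ h T i l} → Stage ρ h T i i l → moveHead l ≡ just (headAt h T (suc i))
head-moves (passed i<i) = contradiction i<i (ℕₚ.<-irrefl refl)
head-moves (reached _)  = refl
head-moves (ahead i<i)  = contradiction i<i (ℕₚ.<-irrefl refl)

-- The cells of a block T whose head h is at its first cell.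
start : Head → (ℕ → Tape) → ℕ → Cell
start h T zero    = just h , T zero
start h T (suc i) = nothing , T (suc i)

module Sweep (m′ : ℕ) where

  -- The size of a block.
  m = suc m′

  -- In the configuration c every block b has the tape T b and, at its first cell, the
  -- head h b.
  Rep : (ℤ → Head) → (ℤ → ℕ → Tape) → Conf Cell → Set
  Rep h T c = ∀ b i → i ℕ.< m → c (pos m b i) ≡ start (h b) (T b) i

  module _ (h : ℤ → Head) (T : ℤ → ℕ → Tape) (ends : ∀ b → proj₂ (T b m′) ≡ last)
           (σ : ℕ → Conf Bool) where

    -- The random bit of the cell i of the block b at the time when the head is there.
    ρ : ℤ → ℕ → Bool
    ρ b i = σ i (pos m b i)

    AtStage : ℕ → Conf Cell → Set
    AtStage j c = ∀ b i → i ℕ.< m → Stage (ρ b) (h b) (T b) j i (c (pos m b i))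

    start-stage : ∀ c → Rep h T c → AtStage 0 c
    start-stage c rep b i i<m rewrite rep b i i<m with i
    ... | zero  = reached refl
    ... | suc i = ahead ℕ.z<s

    pos-left : ∀ b i → pos m b (suc i) + -1ℤ ≡ pos m b i
    pos-left b i = eq (+ m * b) (+ i)
      where
      eq : ∀ a i → a + (1ℤ + i) + -1ℤ ≡ a + i
      eq = solve-∀

    pos-left₀ : ∀ b → pos m b 0 + -1ℤ ≡ pos m (b + -1ℤ) m′
    pos-left₀ b = eq (+ m′) b
      where
      eq : ∀ m b → (1ℤ + m) * b + 0ℤ + -1ℤ ≡ (1ℤ + m) * (b + -1ℤ) + m
      eq = solve-∀

    pos-right : ∀ b i → pos m b i + 1ℤ ≡ pos m b (suc i)
    pos-right b i = eq (+ m * b) (+ i)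
      where
      eq : ∀ a i → a + i + 1ℤ ≡ a + (1ℤ + i)
      eq = solve-∀

    -- The right neighbour of the head belongs to the same block and is still
    -- unchanged, except at the end of the block, where its instruction is not used.
    lookahead : ∀ {j} c → AtStage j c → ∀ b i → i ℕ.< m → i ≡ j →
                Lookahead (T b) i (c (pos m b (suc i)))
    lookahead {j} c st b i i<m refl ρ₀ h₀ with suc i ℕₚ.<? m
    lookahead {j} c st b i i<m refl ρ₀ h₀ | yes si<m with c (pos m b (suc i)) | st b (suc i) si<m
    ... | _ | passed si<i = contradiction (ℕₚ.<-trans (ℕₚ.n<1+n _) si<i) (ℕₚ.<-irrefl refl)
    ... | _ | ahead _     = refl
    lookahead {j} c st b i i<m refl ρ₀ h₀ | no si≮m
      with refl ← ℕₚ.≤-antisym (ℕ.s≤s⁻¹ i<m) (ℕ.s≤s⁻¹ (ℕₚ.≮⇒≥ si≮m))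
      with T b i | ends b
    ... | _ , last | refl = refl

    step : ∀ {j} c → j ℕ.< m′ → AtStage j c → AtStage (suc j) (global universal c (σ j))
    step {j} c j<m′ st b zero i<m =
      subst (Stage (ρ b) (h b) (T b) (suc j) 0)
        (sym (trans (global-universal c (σ j) (pos-left₀ b) (pos-right b 0))
          (cong₂ _,_ (head-none (st (b + -1ℤ) m′ (ℕₚ.n<1+n m′)) (ℕₚ.>⇒≢ j<m′))
            (tape-step (c (pos m b 0)) (c (pos m b 1)) (st b 0 i<m) ℕ.z≤n
              (λ { refl → refl }) (lookahead c st b 0 i<m)))))
        (passed ℕ.z<s)
    step {j} c j<m′ st b (suc i) si<m =
      subst (Stage (ρ b) (h b) (T b) (suc j) (suc i))
        (sym (global-universal c (σ j) (pos-left b i) (pos-right b (suc i))))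
        (stage-step (c (pos m b (suc (suc i)))) (st b i (ℕₚ.<-trans (ℕₚ.n<1+n i) si<m))
          (st b (suc i) si<m) (λ { refl → refl }) (lookahead c st b (suc i) si<m))

    steps : ∀ c → Rep h T c → ∀ j → j ℕ.≤ m′ → AtStage j (run universal c σ j)
    steps c rep zero    j≤m′ = start-stage c rep
    steps c rep (suc j) j<m′ = step (run universal c σ j) j<m′ (steps c rep j (ℕₚ.<⇒≤ j<m′))

    -- After m steps each head is at the start of the next block.
    sweep : ∀ c → Rep h T c →
            Rep (λ b → headAt (h (b + -1ℤ)) (T (b + -1ℤ)) m) (λ b → swept (ρ b) (h b) (T b))
                (run universal c σ m)
    sweep c₀ rep b zero i<m =
      trans (global-universal c (σ m′) (pos-left₀ b) (pos-right b 0))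
        (cong₂ _,_ (head-moves (st (b + -1ℤ) m′ (ℕₚ.n<1+n m′)))
          (tape-step (c (pos m b 0)) (c (pos m b 1)) (st b 0 i<m) ℕ.z≤n
              (λ { refl → refl }) (lookahead c st b 0 i<m)))
      where
      c = run universal c₀ σ m′
      st = steps c₀ rep m′ ℕₚ.≤-refl
    sweep c₀ rep b (suc i) si<m =
      trans (global-universal c (σ m′) (pos-left b i) (pos-right b (suc i)))
        (cong₂ _,_ (head-none (st b i (ℕₚ.<-trans (ℕₚ.n<1+n i) si<m)) (ℕₚ.<⇒≢ (ℕ.s≤s⁻¹ si<m)))
          (tape-step (c (pos m b (suc i))) (c (pos m b (suc (suc i)))) (st b (suc i) si<m)
            (ℕ.s≤s⁻¹ si<m) (λ { refl → refl }) (lookahead c st b (suc i) si<m)))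
      where
      c = run universal c₀ σ m′
      st = steps c₀ rep m′ ℕₚ.≤-refl

-- Blocks as lists of tapes

-- The tape at a position; the value beyond the end of the list is irrelevant.
at : List Tape → ℕ → Tape
at []       i       = reset , last
at (t ∷ ts) zero    = t
at (t ∷ ts) (suc i) = at ts i

-- headAt and swept, by recursion on the list of tapes of a block.
headEnd : Head → List Tape → Head
headEnd h []       = h
headEnd h (t ∷ ts) = headEnd (advance h t) ts

sweptList : (ℕ → Bool) → Head → List Tape → List Tape
sweptList ρ h []       = []
sweptList ρ h (t ∷ ts) = write (ρ 0) h t (proj₁ (at ts 0)) ∷ sweptList (ρ ∘ suc) (advance h t) ts

headAt-suc : ∀ h T i → headAt h T (suc i) ≡ headAt (advance h (T 0)) (T ∘ suc) i
headAt-suc h T zero    = refl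
headAt-suc h T (suc i) = cong (λ h → advance h (T (suc i))) (headAt-suc h T i)

headAt-length : ∀ h ts → headAt h (at ts) (length ts) ≡ headEnd h ts
headAt-length h []       = refl
headAt-length h (t ∷ ts) =
  trans (headAt-suc h (at (t ∷ ts)) (length ts)) (headAt-length (advance h t) ts)

swept-at : ∀ ρ h ts {i} → i ℕ.< length ts → swept ρ h (at ts) i ≡ at (sweptList ρ h ts) i
swept-at ρ h (t ∷ ts) {zero}  i<n = refl
swept-at ρ h (t ∷ ts) {suc i} i<n =
  trans (cong (λ h → write (ρ (suc i)) h (at ts i) (proj₁ (at ts (suc i)))) (headAt-suc h (at (t ∷ ts)) i))
        (swept-at (ρ ∘ suc) (advance h t) ts (ℕ.s≤s⁻¹ i<n))

at-++ʳ : ∀ ts us i → at (ts List.++ us) (length ts ℕ.+ i) ≡ at us i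
at-++ʳ []       us i = refl
at-++ʳ (t ∷ ts) us i = at-++ʳ ts us i

-- Segments

-- The cells of a segment that follow its first cell.
segmentTail : List Instr → List Tape
segmentTail []               = []
segmentTail (i ∷ [])         = (i , last) ∷ []
segmentTail (i ∷ is@(_ ∷ _)) = (i , middle) ∷ segmentTail is

-- A segment with data bits s and o and the given instructions.
segment : Bool → Bool → List Instr → List Tape
segment s o []       = []
segment s o (i ∷ is) = (i , first s o) ∷ segmentTail is

headEnd-segmentTail : ∀ r c i is ts →
  headEnd (r , c) (segmentTail (i ∷ is) List.++ ts) ≡ headEnd (r , reset) ts
headEnd-segmentTail r c i []       ts = refl
headEnd-segmentTail r c i (j ∷ is) ts = headEnd-segmentTail r c j is ts

at-segmentTail-0 : ∀ i is ts → proj₁ (at (segmentTail (i ∷ is) List.++ ts) 0) ≡ i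
at-segmentTail-0 i []       ts = refl
at-segmentTail-0 i (j ∷ is) ts = refl

segmentTail-∷ : ∀ i is c → (i , middle) ∷ segmentTail (is ∷ʳ c) ≡ segmentTail (i ∷ is ∷ʳ c)
segmentTail-∷ i []       c = refl
segmentTail-∷ i (j ∷ is) c = refl

-- Past the first cell the instructions move left, and the carried one, c, is appended.
sweptList-segmentTail : ∀ ρ r c i is ts → sweptList ρ (r , c) (segmentTail (i ∷ is) List.++ ts) ≡
  segmentTail (is ∷ʳ c) List.++ sweptList (λ k → ρ (suc (length is) ℕ.+ k)) (r , reset) ts
sweptList-segmentTail ρ r c i []       ts = refl
sweptList-segmentTail ρ r c i (j ∷ is) ts = begin
  (proj₁ (at (segmentTail (j ∷ is) List.++ ts) 0) , middle) ∷
    sweptList (ρ ∘ suc) (r , c) (segmentTail (j ∷ is) List.++ ts)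
    ≡⟨ cong₂ (λ n us → (n , middle) ∷ us)
         (at-segmentTail-0 j is ts) (sweptList-segmentTail (ρ ∘ suc) r c j is ts) ⟩
  (j , middle) ∷ segmentTail (is ∷ʳ c) List.++ us
    ≡⟨ cong (List._++ us) (segmentTail-∷ j is c) ⟩
  segmentTail (j ∷ is ∷ʳ c) List.++ us ∎
  where us = sweptList (λ k → ρ (2 ℕ.+ length is ℕ.+ k)) (r , reset) ts

headEnd-segment : ∀ r c s o i j is ts →
  headEnd (r , c) (segment s o (i ∷ j ∷ is) List.++ ts) ≡ headEnd (nextR i r s , reset) ts
headEnd-segment r c s o i j is ts = headEnd-segmentTail (nextR i r s) i j is ts

-- A sweep executes the first instruction of a segment and rotates the segment.
sweptList-segment : ∀ ρ r c s o i j is ts → sweptList ρ (r , c) (segment s o (i ∷ j ∷ is) List.++ ts) ≡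
  segment (nextS i (ρ 0) s o) (nextO i r o) (j ∷ is ∷ʳ i) List.++
  sweptList (λ k → ρ (2 ℕ.+ length is ℕ.+ k)) (nextR i r s , reset) ts
sweptList-segment ρ r c s o i j is ts = cong₂ (λ n us → (n , first _ _) ∷ us)
  (at-segmentTail-0 j is ts) (sweptList-segmentTail (ρ ∘ suc) (nextR i r s) i j is ts)

-- Programs

-- One instruction for each segment of a block.
Row : ℕ → Set
Row = Vec Instr

private variable
  K : ℕ

-- The block with stored bits S, output bits O and the given program: the j-th
-- segment contains the j-th instruction of every row.
layout : Vec Bool K → Vec Bool K → List (Row K) → List Tape
layout []      []      rows = []
layout (s ∷ S) (o ∷ O) rows =
  segment s o (List.map Vec.head rows) List.++ layout S O (List.map Vec.tail rows)

-- The effect of a row on the flag, the stored bits and the output bits, where the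
-- instructions are executed from left to right and the flag is passed on.
rowR : Row K → Bool → Vec Bool K → Bool
rowR []       r []      = r
rowR (i ∷ is) r (s ∷ S) = rowR is (nextR i r s) S

rowS : Row K → Vec Bool K → Vec Bool K → Vec Bool K → Vec Bool K
rowS []       []       []      []      = []
rowS (i ∷ is) (ρ ∷ ρs) (s ∷ S) (o ∷ O) = nextS i ρ s o ∷ rowS is ρs S O

rowO : Row K → Bool → Vec Bool K → Vec Bool K → Vec Bool K
rowO []       r []      []      = []
rowO (i ∷ is) r (s ∷ S) (o ∷ O) = nextO i r o ∷ rowO is (nextR i r s) S O

-- The values of x at the first cells of the K segments of length G.
samples : ℕ → (K : ℕ) → (ℕ → X) → Vec X K
samples G zero    x = []
samples G (suc K) x = x 0 ∷ samples G K (λ i → x (G ℕ.+ i))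

samples-cong : ∀ g K {x y : ℕ → X} → (∀ i → i ℕ.< K ℕ.* suc g → x i ≡ y i) →
               samples (suc g) K x ≡ samples (suc g) K y
samples-cong g zero    eq = refl
samples-cong g (suc K) eq = cong₂ _∷_ (eq 0 ℕ.z<s)
  (samples-cong g K (λ i i<n → eq (suc g ℕ.+ i) (ℕₚ.+-monoʳ-< (suc g) i<n)))

headEnd-layout : ∀ r (S O : Vec Bool K) row row′ rows →
  headEnd (r , reset) (layout S O (row ∷ row′ ∷ rows)) ≡ (rowR row r S , reset)
headEnd-layout r []      []      []       row′      rows = refl
headEnd-layout r (s ∷ S) (o ∷ O) (i ∷ is) (j ∷ js) rows =
  trans (headEnd-segment r reset s o i j (List.map Vec.head rows) _)
        (headEnd-layout (nextR i r s) S O is js (List.map Vec.tail rows))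

-- A sweep executes the first row of the program and moves it to the end. The
-- random bits that count are those of the first cells of the segments.
sweptList-layout : ∀ ρ r (S O : Vec Bool K) row row′ rows {g} → length rows ≡ g →
  sweptList ρ (r , reset) (layout S O (row ∷ row′ ∷ rows)) ≡
  layout (rowS row (samples (2 ℕ.+ g) K ρ) S O) (rowO row r S O) (row′ ∷ rows ∷ʳ row)
sweptList-layout ρ r []      []      []       row′     rows     len = refl
sweptList-layout {K = suc K} ρ r (s ∷ S) (o ∷ O) (i ∷ is) (j ∷ js) rows {g} len = begin
  sweptList ρ (r , reset) (segment s o (i ∷ j ∷ hs) List.++ tl)
    ≡⟨ sweptList-segment ρ r reset s o i j hs tl ⟩
  segment s′ o′ (j ∷ hs ∷ʳ i) List.++ swept-tl (length hs)
    ≡⟨ cong (λ n → segment s′ o′ (j ∷ hs ∷ʳ i) List.++ swept-tl n)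
         (trans (Listₚ.length-map Vec.head rows) len) ⟩
  segment s′ o′ (j ∷ hs ∷ʳ i) List.++ swept-tl g
    ≡⟨ cong (segment s′ o′ (j ∷ hs ∷ʳ i) List.++_)
         (sweptList-layout (λ k → ρ (2 ℕ.+ g ℕ.+ k)) (nextR i r s) S O is js ts
           (trans (Listₚ.length-map Vec.tail rows) len)) ⟩
  segment s′ o′ (j ∷ hs ∷ʳ i) List.++ layout S′ O′ (js ∷ ts ∷ʳ is)
    ≡⟨ cong₂ (λ us vs → segment s′ o′ (j ∷ us) List.++ layout S′ O′ (js ∷ vs))
         (Listₚ.map-++ Vec.head rows _) (Listₚ.map-++ Vec.tail rows _) ⟨
  segment s′ o′ (List.map Vec.head ((j ∷ js) ∷ rows ∷ʳ (i ∷ is))) List.++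
    layout S′ O′ (List.map Vec.tail ((j ∷ js) ∷ rows ∷ʳ (i ∷ is))) ∎
  where
  hs = List.map Vec.head rows
  ts = List.map Vec.tail rows
  tl = layout S O (is ∷ js ∷ ts)
  swept-tl = λ n → sweptList (λ k → ρ (2 ℕ.+ n ℕ.+ k)) (nextR i r s , reset) tl
  s′ = nextS i (ρ 0) s o
  o′ = nextO i r o
  S′ = rowS is (samples (2 ℕ.+ g) K (λ k → ρ (2 ℕ.+ g ℕ.+ k))) S O
  O′ = rowO is (nextR i r s) S O

length-segmentTail : ∀ is → length (segmentTail is) ≡ length is
length-segmentTail []           = refl
length-segmentTail (i ∷ [])     = refl
length-segmentTail (i ∷ j ∷ is) = cong suc (length-segmentTail (j ∷ is))

length-segment : ∀ s o is → length (segment s o is) ≡ length is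
length-segment s o []       = refl
length-segment s o (i ∷ is) = cong suc (length-segmentTail is)

length-layout : ∀ (S O : Vec Bool K) rows → length (layout S O rows) ≡ K ℕ.* length rows
length-layout []      []      rows = refl
length-layout {K = suc K} (s ∷ S) (o ∷ O) rows = begin
  length (segment s o (List.map Vec.head rows) List.++ layout S O (List.map Vec.tail rows))
    ≡⟨ Listₚ.length-++ (segment s o (List.map Vec.head rows)) ⟩
  length (segment s o (List.map Vec.head rows)) ℕ.+ length (layout S O (List.map Vec.tail rows))
    ≡⟨ cong₂ ℕ._+_ (trans (length-segment s o (List.map Vec.head rows)) (Listₚ.length-map Vec.head rows))
         (trans (length-layout S O _) (cong (K ℕ.*_) (Listₚ.length-map Vec.tail rows))) ⟩
  length rows ℕ.+ K ℕ.* length rows ∎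

segmentTail-ends : ∀ i is → ∃[ ts ] ∃[ j ] segmentTail (i ∷ is) ≡ ts ∷ʳ (j , last)
segmentTail-ends i []       = [] , i , refl
segmentTail-ends i (j ∷ is) with ts , k , eq ← segmentTail-ends j is =
  (i , middle) ∷ ts , k , cong ((i , middle) ∷_) eq

layout-ends : ∀ (S O : Vec Bool (suc K)) row row′ rows →
  ∃[ ts ] ∃[ j ] layout S O (row ∷ row′ ∷ rows) ≡ ts ∷ʳ (j , last)
layout-ends {zero} (s ∷ []) (o ∷ []) (i ∷ []) (j ∷ []) rows
  with ts , k , eq ← segmentTail-ends j (List.map Vec.head rows) =
  (i , first s o) ∷ ts , k , cong ((i , first s o) ∷_) (trans (Listₚ.++-identityʳ _) eq)
layout-ends {suc K} (s ∷ S) (o ∷ O) (i ∷ is) (j ∷ js) rows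
  with ts , k , eq ← layout-ends S O is js (List.map Vec.tail rows) =
  seg List.++ ts , k , trans (cong (seg List.++_) eq) (sym (Listₚ.++-assoc seg ts _))
  where seg = segment s o (i ∷ j ∷ List.map Vec.head rows)

ends-at : ∀ {us ts} {j n} → us ≡ ts ∷ʳ (j , last) → length us ≡ suc n → proj₂ (at us n) ≡ last
ends-at {ts = ts} {j} {n} refl len =
  cong proj₂ (trans (cong (at (ts ∷ʳ (j , last))) n≡) (at-++ʳ ts ((j , last) ∷ []) 0))
  where
  n≡ : n ≡ length ts ℕ.+ 0
  n≡ = ℕₚ.suc-injective (trans (sym len) (trans (Listₚ.length-++ ts) (ℕₚ.+-suc (length ts) 0)))

-- The dynamics of blocks under complete sweeps

-- For each block, the flag of its head and its stored and output bits.
record Macro (K : ℕ) : Set where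
  field
    flag          : ℤ → Bool
    stored output : ℤ → Vec Bool K

open Macro

-- One row. The flag comes from the block on the left, which the head has just
-- crossed; ρ gives the random bits of the block.
stepM : Row K → (ℤ → Vec Bool K) → Macro K → Macro K
stepM row ρ M = record
  { flag   = λ b → rowR row (flag M (b + -1ℤ)) (stored M (b + -1ℤ))
  ; stored = λ b → rowS row (ρ b) (stored M b) (output M b)
  ; output = λ b → rowO row (flag M b) (stored M b) (output M b)
  }

runM : List (Row K) → (ℕ → ℤ → Vec Bool K) → Macro K → Macro K
runM []           ρ M = M
runM (row ∷ rows) ρ M = runM rows (ρ ∘ suc) (stepM row (ρ 0) M)

-- Blocks have suc k segments and programs have G = 2 + g rows: a block has at least
-- one segment, and the first cell of a segment differs from the last one.
module Execution (k g : ℕ) where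

  G = 2 ℕ.+ g
  size = suc k ℕ.* G
  open Sweep (ℕ.pred size)

  Represents : Macro (suc k) → List (Row (suc k)) → Conf Cell → Set
  Represents M rows = Rep (λ b → flag M b , reset) (λ b → at (layout (stored M b) (output M b) rows))

  -- The random bits that the blocks use in the n-th sweep.
  randomness : (ℕ → Conf Bool) → ℕ → ℤ → Vec Bool (suc k)
  randomness σ n b = samples G (suc k) (λ i → σ (n ℕ.* size ℕ.+ i) (pos size b i))

  execute-row : ∀ M row row′ rows c σ → length rows ≡ g → ∀ ρ → (∀ b → ρ b ≡ randomness σ 0 b) →
    Represents M (row ∷ row′ ∷ rows) c →
    Represents (stepM row ρ M) (row′ ∷ rows ∷ʳ row) (run universal c σ size)
  execute-row M row row′ rows c σ len ρ ρ≡ rep b i i<m =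
    trans (sweep (λ b → flag M b , reset) (λ b → at (L b)) ends σ c rep b i i<m) (final i i<m)
    where
    M′ = stepM row ρ M
    L L′ : ℤ → List Tape
    L b = layout (stored M b) (output M b) (row ∷ row′ ∷ rows)
    L′ b = layout (stored M′ b) (output M′ b) (row′ ∷ rows ∷ʳ row)
    noise : ℕ → Bool
    noise i = σ i (pos size b i)
    length-L : ∀ b → length (L b) ≡ size
    length-L b = trans (length-layout (stored M b) (output M b) _)
                       (cong (λ n → suc k ℕ.* (2 ℕ.+ n)) len)
    ends : ∀ b → proj₂ (at (L b) (ℕ.pred size)) ≡ last
    ends b with ts , j , eq ← layout-ends (stored M b) (output M b) row row′ rows =
      ends-at eq (length-L b)
    tape-final : ∀ i → i ℕ.< size → swept noise (flag M b , reset) (at (L b)) i ≡ at (L′ b) i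
    tape-final i i<m = begin
      swept noise (flag M b , reset) (at (L b)) i
        ≡⟨ swept-at _ _ (L b) (subst (i ℕ.<_) (sym (length-L b)) i<m) ⟩
      at (sweptList noise (flag M b , reset) (L b)) i
        ≡⟨ cong (λ ts → at ts i)
             (sweptList-layout noise (flag M b) (stored M b) (output M b) row row′ rows len) ⟩
      at (layout (rowS row (randomness σ 0 b) (stored M b) (output M b)) (output M′ b) _) i
        ≡⟨ cong (λ v → at (layout (rowS row v (stored M b) (output M b)) (output M′ b) _) i)
             (ρ≡ b) ⟨
      at (L′ b) i ∎
    head-final : ∀ b → headAt (flag M b , reset) (at (L b)) size ≡
                       (rowR row (flag M b) (stored M b) , reset)
    head-final b = begin
      headAt (flag M b , reset) (at (L b)) size
        ≡⟨ cong (headAt _ (at (L b))) (length-L b) ⟨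
      headAt (flag M b , reset) (at (L b)) (length (L b))
        ≡⟨ headAt-length _ (L b) ⟩
      headEnd (flag M b , reset) (L b)
        ≡⟨ headEnd-layout (flag M b) (stored M b) (output M b) row row′ rows ⟩
      rowR row (flag M b) (stored M b) , reset ∎
    final : ∀ i → i ℕ.< size →
      start (headAt (flag M (b + -1ℤ) , reset) (at (L (b + -1ℤ))) size)
            (swept noise (flag M b , reset) (at (L b))) i ≡
      start (flag M′ b , reset) (at (L′ b)) i
    final zero    i<m = cong₂ (λ h t → just h , t) (head-final (b + -1ℤ)) (tape-final 0 i<m)
    final (suc i) i<m = cong (nothing ,_) (tape-final (suc i) i<m)

  -- The rows done so far have been moved to the end of the program.
  execute : ∀ todo {done} M c σ → length (todo List.++ done) ≡ G →
    ∀ ρ → (∀ n b → ρ n b ≡ randomness σ n b) →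
    Represents M (todo List.++ done) c →
    Represents (runM todo ρ M) (done List.++ todo) (run universal c σ (length todo ℕ.* size))
  execute [] {done} M c σ len ρ ρ≡ rep =
    subst (λ rows → Represents M rows c) (sym (Listₚ.++-identityʳ done)) rep
  execute (row ∷ todo) {done} M c σ len ρ ρ≡ rep with todo List.++ done in eq
  ... | row′ ∷ rows =
    subst₂ (Represents (runM (row ∷ todo) ρ M)) (Listₚ.++-assoc done (row ∷ []) todo)
      (sym (run-+ universal c σ size (length todo ℕ.* size)))
      (execute todo (stepM row (ρ 0) M) (run universal c σ size) (λ n → σ (size ℕ.+ n))
        (trans (cong length eq′) (trans (Listₚ.length-++ (row′ ∷ rows)) (trans (ℕₚ.+-comm _ 1) len)))
        (ρ ∘ suc)
        (λ n b → trans (ρ≡ (suc n) b) (samples-cong (suc g) (suc k) λ i _ →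
          cong (λ n → σ n (pos size b i)) (ℕₚ.+-assoc size (n ℕ.* size) i)))
        (subst (λ rows → Represents (stepM row (ρ 0) M) rows (run universal c σ size)) (sym eq′)
          (execute-row M row row′ rows c σ (ℕₚ.suc-injective (ℕₚ.suc-injective len)) (ρ 0) (ρ≡ 0) rep)))
    where
    eq′ : todo List.++ (done ∷ʳ row) ≡ row′ ∷ rows ∷ʳ row
    eq′ = trans (sym (Listₚ.++-assoc todo done _)) (cong (_∷ʳ row) eq)
  ... | [] with () ← len

-- Particular rows

checkRow putRow : Vec Bool K → Row K
checkRow = Vec.map check
putRow   = Vec.map put

resetRow commitRow : Row K
resetRow  = Vec.replicate _ reset
commitRow = Vec.replicate _ commit

sampleRow : ∀ a b → Row (a ℕ.+ b)
sampleRow a b = Vec.replicate a sample Vec.++ Vec.replicate b reset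

rowS-check : ∀ (w ρ S O : Vec Bool K) → rowS (checkRow w) ρ S O ≡ S
rowS-check []      []      []      []      = refl
rowS-check (b ∷ w) (_ ∷ ρ) (s ∷ S) (_ ∷ O) = cong (s ∷_) (rowS-check w ρ S O)

rowO-check : ∀ (w S O : Vec Bool K) r → rowO (checkRow w) r S O ≡ O
rowO-check []      []      []      r = refl
rowO-check (b ∷ w) (s ∷ S) (o ∷ O) r = cong (o ∷_) (rowO-check w S O _)

rowR-check⁻ : ∀ (w S : Vec Bool K) r → rowR (checkRow w) r S ≡ true → r ≡ true × w ≡ S
rowR-check⁻ []          []          r    eq = eq , refl
rowR-check⁻ (false ∷ w) (s ∷ S)     r    eq with rowR-check⁻ w S _ eq
rowR-check⁻ (false ∷ w) (false ∷ S) true eq | _ , w≡S = refl , cong (false ∷_) w≡S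
rowR-check⁻ (true ∷ w)  (s ∷ S)     r    eq with rowR-check⁻ w S _ eq
rowR-check⁻ (true ∷ w)  (true ∷ S)  true eq | _ , w≡S = refl , cong (true ∷_) w≡S

rowR-check⁺ : ∀ (w : Vec Bool K) → rowR (checkRow w) true w ≡ true
rowR-check⁺ []          = refl
rowR-check⁺ (false ∷ w) = rowR-check⁺ w
rowR-check⁺ (true ∷ w)  = rowR-check⁺ w

rowS-put : ∀ (u ρ S O : Vec Bool K) → rowS (putRow u) ρ S O ≡ S
rowS-put []      []      []      []      = refl
rowS-put (b ∷ u) (_ ∷ ρ) (s ∷ S) (_ ∷ O) = cong (s ∷_) (rowS-put u ρ S O)

rowO-put-true : ∀ (u S O : Vec Bool K) → rowO (putRow u) true S O ≡ u
rowO-put-true []      []      []      = refl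
rowO-put-true (b ∷ u) (s ∷ S) (o ∷ O) = cong (b ∷_) (rowO-put-true u S O)

rowO-put-false : ∀ (u S O : Vec Bool K) → rowO (putRow u) false S O ≡ O
rowO-put-false []      []      []      = refl
rowO-put-false (b ∷ u) (s ∷ S) (o ∷ O) = cong (o ∷_) (rowO-put-false u S O)

rowR-reset-true : ∀ (S : Vec Bool K) → rowR resetRow true S ≡ true
rowR-reset-true []      = refl
rowR-reset-true (s ∷ S) = rowR-reset-true S

rowR-reset : ∀ (S : Vec Bool (suc K)) r → rowR resetRow r S ≡ true
rowR-reset (s ∷ S) r = rowR-reset-true S

rowS-reset : ∀ (ρ S O : Vec Bool K) → rowS resetRow ρ S O ≡ S
rowS-reset []      []      []      = refl
rowS-reset (_ ∷ ρ) (s ∷ S) (_ ∷ O) = cong (s ∷_) (rowS-reset ρ S O)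

rowO-reset : ∀ (S O : Vec Bool K) r → rowO resetRow r S O ≡ O
rowO-reset []      []      r = refl
rowO-reset (s ∷ S) (o ∷ O) r = cong (o ∷_) (rowO-reset S O _)

rowR-commit : ∀ (S : Vec Bool K) r → rowR commitRow r S ≡ r
rowR-commit []      r = refl
rowR-commit (s ∷ S) r = rowR-commit S r

rowS-commit : ∀ (ρ S O : Vec Bool K) → rowS commitRow ρ S O ≡ O
rowS-commit []      []      []      = refl
rowS-commit (_ ∷ ρ) (_ ∷ S) (o ∷ O) = cong (o ∷_) (rowS-commit ρ S O)

rowO-commit : ∀ (S O : Vec Bool K) r → rowO commitRow r S O ≡ Vec.replicate K false
rowO-commit []      []      r = refl
rowO-commit (s ∷ S) (o ∷ O) r = cong (false ∷_) (rowO-commit S O r)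

rowR-sample : ∀ a b (S : Vec Bool (a ℕ.+ b)) → rowR (sampleRow a b) true S ≡ true
rowR-sample zero    b S       = rowR-reset-true S
rowR-sample (suc a) b (s ∷ S) = rowR-sample a b S

rowS-sample : ∀ a b (ρ O : Vec Bool (a ℕ.+ b)) u v →
              rowS (sampleRow a b) ρ (u Vec.++ v) O ≡ Vec.take a ρ Vec.++ v
rowS-sample zero    b ρ       O       []      v = rowS-reset ρ v O
rowS-sample (suc a) b (x ∷ ρ) (o ∷ O) (_ ∷ u) v = cong (x ∷_) (rowS-sample a b ρ O u v)

runM-++ : ∀ (xs ys : List (Row K)) ρ M →
  runM (xs List.++ ys) ρ M ≡ runM ys (λ n → ρ (length xs ℕ.+ n)) (runM xs ρ M)
runM-++ []       ys ρ M = refl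
runM-++ (x ∷ xs) ys ρ M = runM-++ xs ys (ρ ∘ suc) (stepM x (ρ 0) M)

-- Windows

-- The values of y at the n consecutive cells from p on.
window : Conf X → ℤ → (n : ℕ) → Vec X n
window y p zero    = []
window y p (suc n) = y p ∷ window y (p + 1ℤ) n

lookup-window : ∀ (y : Conf X) p (i : Fin n) → lookup (window y p n) i ≡ y (p + + toℕ i)
lookup-window y p Fin.zero    = cong y (sym (ℤₚ.+-identityʳ p))
lookup-window y p (Fin.suc i) = trans (lookup-window y (p + 1ℤ) i) (cong y (ℤₚ.+-assoc p 1ℤ (+ toℕ i)))

window-map : ∀ (f : X → Y) y p n → window (f ∘ y) p n ≡ Vec.map f (window y p n)
window-map f y p zero    = refl
window-map f y p (suc n) = cong (f (y p) ∷_) (window-map f y (p + 1ℤ) n)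

map-injective : {f : X → Y} → Injective _≡_ _≡_ f → Injective _≡_ _≡_ (Vec.map {n = n} f)
map-injective f-inj {[]}     {[]}     eq = refl
map-injective f-inj {x ∷ xs} {y ∷ ys} eq =
  cong₂ _∷_ (f-inj (Vecₚ.∷-injectiveˡ eq)) (map-injective f-inj (Vecₚ.∷-injectiveʳ eq))

-- Comparison with a window

-- One row for each of the n blocks that a head crosses.
checks : Vec (Vec Bool K) n → List (Row K)
checks []       = []
checks (w ∷ ws) = checkRow w ∷ checks ws

-- The final flag of a head with flag r that starts at the block p.
checkFrom : Vec (Vec Bool K) n → Bool → Conf (Vec Bool K) → ℤ → Bool
checkFrom []       r y p = r
checkFrom (w ∷ ws) r y p = checkFrom ws (rowR (checkRow w) r (y p)) y (p + 1ℤ)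

checkFrom⁻ : ∀ (ws : Vec (Vec Bool K) n) r y p →
             checkFrom ws r y p ≡ true → r ≡ true × ws ≡ window y p n
checkFrom⁻ []       r y p eq = eq , refl
checkFrom⁻ (w ∷ ws) r y p eq
  with eq′ , ws≡ ← checkFrom⁻ ws _ y (p + 1ℤ) eq
  with r≡ , w≡ ← rowR-check⁻ w (y p) r eq′ = r≡ , cong₂ _∷_ w≡ ws≡

checkFrom⁺ : ∀ (y : Conf (Vec Bool K)) p n → checkFrom (window y p n) true y p ≡ true
checkFrom⁺ y p zero    = refl
checkFrom⁺ y p (suc n) rewrite rowR-check⁺ (y p) = checkFrom⁺ y (p + 1ℤ) n

checkFrom-cong : ∀ (ws : Vec (Vec Bool K) n) r {y y′} p → y ≗ y′ →
                 checkFrom ws r y p ≡ checkFrom ws r y′ p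
checkFrom-cong []       r p eq = refl
checkFrom-cong (w ∷ ws) r {y} {y′} p eq rewrite eq p =
  checkFrom-cong ws (rowR (checkRow w) r (y′ p)) (p + 1ℤ) eq

stored-checks : ∀ (ws : Vec (Vec Bool K) n) ρ M b → stored (runM (checks ws) ρ M) b ≡ stored M b
stored-checks []       ρ M b = refl
stored-checks (w ∷ ws) ρ M b =
  trans (stored-checks ws (ρ ∘ suc) (stepM (checkRow w) (ρ 0) M) b)
        (rowS-check w (ρ 0 b) (stored M b) (output M b))

output-checks : ∀ (ws : Vec (Vec Bool K) n) ρ M b → output (runM (checks ws) ρ M) b ≡ output M b
output-checks []       ρ M b = refl
output-checks (w ∷ ws) ρ M b =
  trans (output-checks ws (ρ ∘ suc) (stepM (checkRow w) (ρ 0) M) b)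
        (rowO-check w (stored M b) (output M b) (flag M b))

flag-checks : ∀ (ws : Vec (Vec Bool K) n) ρ M b →
  flag (runM (checks ws) ρ M) (b + + n) ≡ checkFrom ws (flag M b) (stored M) b
flag-checks []       ρ M b = cong (flag M) (ℤₚ.+-identityʳ b)
flag-checks {n = suc n} (w ∷ ws) ρ M b = begin
  flag (runM (checks ws) (ρ ∘ suc) M′) (b + + suc n)
    ≡⟨ cong (flag (runM (checks ws) (ρ ∘ suc) M′)) (ℤₚ.+-assoc b 1ℤ (+ n)) ⟨
  flag (runM (checks ws) (ρ ∘ suc) M′) (b + 1ℤ + + n)
    ≡⟨ flag-checks ws (ρ ∘ suc) M′ (b + 1ℤ) ⟩
  checkFrom ws (flag M′ (b + 1ℤ)) (stored M′) (b + 1ℤ)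
    ≡⟨ checkFrom-cong ws _ (b + 1ℤ) (λ b → rowS-check w (ρ 0 b) (stored M b) (output M b)) ⟩
  checkFrom ws (flag M′ (b + 1ℤ)) (stored M) (b + 1ℤ)
    ≡⟨ cong (λ a → checkFrom ws (rowR (checkRow w) (flag M a) (stored M a)) (stored M) (b + 1ℤ))
         (eq b) ⟩
  checkFrom (w ∷ ws) (flag M b) (stored M) b ∎
  where
  M′ = stepM (checkRow w) (ρ 0) M
  eq : ∀ b → b + 1ℤ + -1ℤ ≡ b
  eq = solve-∀

-- The transition table

-- The stored bits are y, and all flags are true, as needed to start a comparison.
record Ready (y : Conf (Vec Bool K)) (M : Macro K) : Set where
  field
    flag-true : ∀ b → flag M b ≡ true
    stored-≡  : ∀ b → stored M b ≡ y b

open Ready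

-- The rows that compare the window ws with the blocks crossed and, in case of a
-- match, output u in the block that follows the window.
entry : Vec (Vec Bool K) n → Vec Bool K → List (Row K)
entry ws u = checks ws List.++ putRow u ∷ resetRow ∷ []

module _ (ws : Vec (Vec Bool (suc K)) n) (u : Vec Bool (suc K)) (ρ : ℕ → ℤ → Vec Bool (suc K))
         {y : Conf (Vec Bool (suc K))} {M : Macro (suc K)} (ready : Ready y M) where

  private
    ρ′ = λ k → ρ (length (checks ws) ℕ.+ k)
    M₁ = runM (checks ws) ρ M
    M₂ = stepM (putRow u) (ρ′ 0) M₁
    M₃ = stepM resetRow (ρ′ 1) M₂

    entry-≡ : runM (entry ws u) ρ M ≡ M₃
    entry-≡ = runM-++ (checks ws) (putRow u ∷ resetRow ∷ []) ρ M

    output₃ : ∀ b → output M₃ b ≡ rowO (putRow u) (flag M₁ b) (stored M₁ b) (output M₁ b)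
    output₃ b = rowO-reset (stored M₂ b) (output M₂ b) (flag M₂ b)

    flag₁ : ∀ b → flag M₁ (b + + n) ≡ checkFrom ws true y b
    flag₁ b = trans (flag-checks ws ρ M b)
      (trans (cong (λ r → checkFrom ws r (stored M) b) (flag-true ready b))
             (checkFrom-cong ws true b (stored-≡ ready)))

  entry-ready : Ready y (runM (entry ws u) ρ M)
  entry-ready = subst (Ready y) (sym entry-≡) record
    { flag-true = λ b → rowR-reset (stored M₂ (b + -1ℤ)) (flag M₂ (b + -1ℤ))
    ; stored-≡  = λ b → trans (rowS-reset (ρ′ 1 b) (stored M₂ b) (output M₂ b))
        (trans (rowS-put u (ρ′ 0 b) (stored M₁ b) (output M₁ b))
               (trans (stored-checks ws ρ M b) (stored-≡ ready b)))
    }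

  entry-match : ∀ b → ws ≡ window y b n → output (runM (entry ws u) ρ M) (b + + n) ≡ u
  entry-match b refl rewrite entry-≡ = trans (output₃ (b + + n))
    (trans (cong (λ r → rowO (putRow u) r (stored M₁ (b + + n)) (output M₁ (b + + n)))
             (trans (flag₁ b) (checkFrom⁺ y b n)))
           (rowO-put-true u _ _))

  entry-mismatch : ∀ b → ws ≢ window y b n →
                   output (runM (entry ws u) ρ M) (b + + n) ≡ output M (b + + n)
  entry-mismatch b ws≢ rewrite entry-≡ = trans (output₃ (b + + n))
    (trans (cong (λ r → rowO (putRow u) r (stored M₁ (b + + n)) (output M₁ (b + + n)))
             (trans (flag₁ b) (Boolₚ.¬-not (λ eq → ws≢ (proj₂ (checkFrom⁻ ws true y b eq))))))
           (trans (rowO-put-false u _ _) (output-checks ws ρ M (b + + n))))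

-- The entries for the windows es, with cells encoded by enc.
table : (Y → Vec Bool K) → (Vec Y n → Vec Bool K) → List (Vec Y n) → List (Row K)
table enc u = concatMap (λ e → entry (Vec.map enc e) (u e))

module _ (enc : Y → Vec Bool (suc K)) (enc-injective : Injective _≡_ _≡_ enc)
         (u : Vec Y n → Vec Bool (suc K)) (y : Conf Y) where

  -- A correct output is never overwritten, because only the entry of the actual window
  -- can match; it becomes correct when that entry is met.
  run-table : ∀ es ρ {M} → Ready (enc ∘ y) M → Ready (enc ∘ y) (runM (table enc u es) ρ M) ×
    (∀ b → output M (b + + n) ≡ u (window y b n) ⊎ window y b n ∈ es →
           output (runM (table enc u es) ρ M) (b + + n) ≡ u (window y b n))
  run-table []       ρ {M} ready = ready , λ { b (inj₁ eq) → eq }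
  run-table (e ∷ es) ρ {M} ready
    rewrite runM-++ (entry (Vec.map enc e) (u e)) (table enc u es) ρ M
    with ready″ , out ← run-table es (λ k → ρ (length (entry (Vec.map enc e) (u e)) ℕ.+ k))
                          (entry-ready (Vec.map enc e) (u e) ρ ready) =
    ready″ , λ b h → out b (current b h)
    where
    M′ = runM (entry (Vec.map enc e) (u e)) ρ M
    current : ∀ b → output M (b + + n) ≡ u (window y b n) ⊎ window y b n ∈ e ∷ es →
              output M′ (b + + n) ≡ u (window y b n) ⊎ window y b n ∈ es
    current b h with Vecₚ.≡-dec (Vecₚ.≡-dec Boolₚ._≟_) (Vec.map enc e) (window (enc ∘ y) b n)
    ... | yes eq = inj₁ (trans (entry-match (Vec.map enc e) (u e) ρ ready b eq)
                     (cong u (map-injective enc-injective (trans eq (window-map enc y b n)))))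
    current b (inj₁ eq)           | no e≢ =
      inj₁ (trans (entry-mismatch (Vec.map enc e) (u e) ρ ready b e≢) eq)
    current b (inj₂ (here refl))  | no e≢ = contradiction (sym (window-map enc y b n)) e≢
    current b (inj₂ (there w∈es)) | no e≢ = inj₂ w∈es

-- Binary codes and random bits

oneHot : Fin n → Vec Bool n
oneHot Fin.zero    = true ∷ Vec.replicate _ false
oneHot (Fin.suc i) = false ∷ oneHot i

oneHot-injective : Injective _≡_ _≡_ (oneHot {n})
oneHot-injective {x = Fin.zero}  {Fin.zero}  eq = refl
oneHot-injective {x = Fin.suc i} {Fin.suc j} eq = cong Fin.suc (oneHot-injective (Vecₚ.∷-injectiveʳ eq))

-- The value of g at the position of the first true, or x₀ if there is none.
firstTrue : X → (Fin n → X) → Vec Bool n → X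
firstTrue x₀ g []          = x₀
firstTrue x₀ g (true ∷ v)  = g Fin.zero
firstTrue x₀ g (false ∷ v) = firstTrue x₀ (g ∘ Fin.suc) v

firstTrue-oneHot : ∀ (x₀ : X) (g : Fin n → X) i → firstTrue x₀ g (oneHot i) ≡ g i
firstTrue-oneHot x₀ g Fin.zero    = refl
firstTrue-oneHot x₀ g (Fin.suc i) = firstTrue-oneHot x₀ (g ∘ Fin.suc) i

-- Total lookup, with a default value beyond the end.
get : X → Vec X n → ℕ → X
get x₀ []       i       = x₀
get x₀ (x ∷ xs) zero    = x
get x₀ (x ∷ xs) (suc i) = get x₀ xs i

get-toℕ : ∀ (x₀ : X) (xs : Vec X n) i → get x₀ xs (toℕ i) ≡ lookup xs i
get-toℕ x₀ (x ∷ xs) Fin.zero    = refl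
get-toℕ x₀ (x ∷ xs) (Fin.suc i) = get-toℕ x₀ xs i

get-< : ∀ (x₀ : X) (xs : Vec X n) {i} (i<n : i ℕ.< n) → get x₀ xs i ≡ lookup xs (fromℕ< i<n)
get-< x₀ xs {i} i<n = trans (cong (get x₀ xs) (sym (toℕ-fromℕ< i<n))) (get-toℕ x₀ xs (fromℕ< i<n))

get-++ʳ : ∀ (x₀ : X) {m} (xs : Vec X m) (ys : Vec X n) i →
          get x₀ (xs Vec.++ ys) (m ℕ.+ i) ≡ get x₀ ys i
get-++ʳ x₀ []       ys i = refl
get-++ʳ x₀ (x ∷ xs) ys i = get-++ʳ x₀ xs ys i

take-++ : ∀ {m} (u : Vec X m) (v : Vec X n) → Vec.take m (u Vec.++ v) ≡ u
take-++ []      v = refl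
take-++ (x ∷ u) v = cong (x ∷_) (take-++ u v)

-- The bits of v at the multiples of suc g, and false elsewhere.
spread : ∀ g → Vec Bool K → Vec Bool (K ℕ.* suc g)
spread g []      = []
spread g (b ∷ v) = (b ∷ Vec.replicate g false) Vec.++ spread g v

samples-spread : ∀ g (v : Vec Bool K) → samples (suc g) K (get false (spread g v)) ≡ v
samples-spread {zero}  g []      = refl
samples-spread {suc K} g (b ∷ v) = cong (b ∷_) (trans
  (samples-cong g K (λ i _ → get-++ʳ false (b ∷ Vec.replicate g false) (spread g v) i))
  (samples-spread g v))

get-replicate : ∀ {m} (x₀ x : X) {i} → i ℕ.< m → get x₀ (Vec.replicate m x) i ≡ x
get-replicate {m = suc m} x₀ x {zero}  i<m = refl
get-replicate {m = suc m} x₀ x {suc i} i<m = get-replicate x₀ x (ℕ.s≤s⁻¹ i<m)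

-- The i-th cell of a block is visited at time i of the first sweep, so the random
-- bits that it can use form the diagonal of the time-space matrix w.
diagonal : ∀ {m t} → Vec (Vec Bool m) t → ℕ → Bool
diagonal w i = get false (get (Vec.replicate _ false) w i) i

samples-diagonal : ∀ g (v : Vec Bool K) {t} → K ℕ.* suc g ℕ.≤ t →
                   samples (suc g) K (diagonal (Vec.replicate t (spread g v))) ≡ v
samples-diagonal {K} g v m≤t = trans
  (samples-cong g K (λ i i<m → cong (λ v → get false v i)
    (get-replicate _ (spread g v) (ℕₚ.<-≤-trans i<m m≤t))))
  (samples-spread g v)

-- The random configuration at time i, for random symbols grouped by blocks as in a
-- rescaling. After the time t, where it is not used, it is constantly false.
noiseAt : ∀ {m t} .{{_ : NonZero m}} → Conf (Vec (Vec Bool m) t) → ℕ → Conf Bool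
noiseAt {m} s i = unblock m (λ x → get (Vec.replicate m false) (s x) i)

noiseAt-diagonal : ∀ {m t} .{{_ : NonZero m}} (s : Conf (Vec (Vec Bool m) t)) b {i} → i ℕ.< m →
                   noiseAt s i (pos m b i) ≡ diagonal (s b) i
noiseAt-diagonal {m} s b {i} i<m =
  trans (unblock-pos m (λ x → get (Vec.replicate m false) (s x) i) b i<m)
        (sym (get-< false (get (Vec.replicate m false) (s b) i) i<m))

noiseAt-toℕ : ∀ {m t} .{{_ : NonZero m}} (s : Conf (Vec (Vec Bool m) t)) (k : Fin t) →
              unblock m (λ x → lookup (s x) k) ≗ noiseAt s (toℕ k)
noiseAt-toℕ {m} s k y = cong (λ v → lookup v _) (sym (get-toℕ _ (s (y /ℕ m)) k))

randomness-noiseAt : ∀ k g {t} (s : Conf (Vec (Vec Bool (suc k ℕ.* (2 ℕ.+ g))) t)) b →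
  Execution.randomness k g (noiseAt s) 0 b ≡ samples (2 ℕ.+ g) (suc k) (diagonal (s b))
randomness-noiseAt k g s b = samples-cong (suc g) (suc k) (λ i i<m → noiseAt-diagonal s b i<m)

storedOf : Kind → Bool
storedOf (first s o) = s
storedOf middle      = false
storedOf last        = false

-- The stored bits can be read off the tape of a block.
samples-layout : ∀ g (S O : Vec Bool K) rows → length rows ≡ suc g →
                 samples (suc g) K (storedOf ∘ proj₂ ∘ at (layout S O rows)) ≡ S
samples-layout g []      []      rows         len = refl
samples-layout {suc K} g (s ∷ S) (o ∷ O) rows@((i ∷ is) ∷ _) len = cong (s ∷_) (trans
  (samples-cong g K (λ i _ → cong (storedOf ∘ proj₂) (trans
    (cong (λ n → at (layout (s ∷ S) (o ∷ O) rows) (n ℕ.+ i)) (sym length-seg))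
    (at-++ʳ seg (layout S O (List.map Vec.tail rows)) i))))
  (samples-layout g S O (List.map Vec.tail rows) (trans (Listₚ.length-map Vec.tail rows) len)))
  where
  seg = segment s o (List.map Vec.head rows)
  length-seg : length seg ≡ suc g
  length-seg = trans (length-segment s o (List.map Vec.head rows))
                     (trans (Listₚ.length-map Vec.head rows) len)

-- A complete run of a program

initial : Conf (Vec Bool K) → Macro K
initial c = record
  { flag   = λ _ → true
  ; stored = c
  ; output = λ _ → Vec.replicate _ false
  }

module Blocks (k g : ℕ) (program : List (Row (suc k)))
              (length-program : length program ≡ 2 ℕ.+ g) where

  open Execution k g

  blockCell : Vec Bool (suc k) → ℕ → Cell
  blockCell S = start (true , reset) (at (layout S (Vec.replicate _ false) program))

  -- The block with stored bits S, output bits false, and a head with flag true.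
  blockOf : Vec Bool (suc k) → Vec Cell size
  blockOf S = tabulate (blockCell S ∘ toℕ)

  lookup-blockOf : ∀ S {i} (i<m : i ℕ.< size) → lookup (blockOf S) (fromℕ< i<m) ≡ blockCell S i
  lookup-blockOf S i<m =
    trans (Vecₚ.lookup∘tabulate (blockCell S ∘ toℕ) (fromℕ< i<m)) (cong (blockCell S) (toℕ-fromℕ< i<m))

  blockOf-injective : Injective _≡_ _≡_ blockOf
  blockOf-injective {S} {S′} eq = begin
    S                           ≡⟨ recover S ⟨
    samples G (suc k) (read S)  ≡⟨ samples-cong (suc g) (suc k) read-≡ ⟩
    samples G (suc k) (read S′) ≡⟨ recover S′ ⟩
    S′                          ∎
    where
    read : Vec Bool (suc k) → ℕ → Bool
    read S = storedOf ∘ proj₂ ∘ at (layout S (Vec.replicate _ false) program)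
    recover : ∀ S → samples G (suc k) (read S) ≡ S
    recover S = samples-layout (suc g) S _ program length-program
    tape-start : ∀ h T i → proj₂ (start h T i) ≡ T i
    tape-start h T zero    = refl
    tape-start h T (suc i) = refl
    read-≡ : ∀ i → i ℕ.< size → read S i ≡ read S′ i
    read-≡ i i<m = cong (storedOf ∘ proj₂)
      (trans (sym (tape-start _ _ i)) (trans (cong proj₂ cell-≡) (tape-start _ _ i)))
      where
      cell-≡ : blockCell S i ≡ blockCell S′ i
      cell-≡ = trans (sym (lookup-blockOf S i<m))
        (trans (cong (λ v → lookup v (fromℕ< i<m)) eq) (lookup-blockOf S′ i<m))

  -- One sweep for each row.
  time : ℕ
  time = length program ℕ.* size

  module _ (c : Conf (Vec Bool (suc k))) (s : Conf (Vec (Vec Bool size) time)) where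

    final : Macro (suc k)
    final = runM program (randomness (noiseAt s)) (initial c)

    -- If the flags and the output bits return to their initial values, then the result
    -- consists of encoded blocks, seen here with a displacement by d blocks.
    run-blocks : (∀ x → flag final x ≡ true) → (∀ x → output final x ≡ Vec.replicate _ false) →
      ∀ d x → rescaledGlobal universal size time (+ size * d) (blockOf ∘ c) s x ≡
              blockOf (stored final (x + d))
    run-blocks flag≡ output≡ d x = Vecₚ.tabulate-cong λ j → begin
      iterate universal time c₀ s₀ (+ size * x + + toℕ j + + size * d)
        ≡⟨ iterate≗run universal time c₀ s₀ (noiseAt s) (noiseAt-toℕ s) _ ⟩
      run universal c₀ (noiseAt s) time (+ size * x + + toℕ j + + size * d)
        ≡⟨ cong (run universal c₀ (noiseAt s) time) (eq (+ size) x (+ toℕ j) d) ⟩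
      run universal c₀ (noiseAt s) time (pos size (x + d) (toℕ j))
        ≡⟨ execute program (initial c) c₀ (noiseAt s)
             (trans (cong length (Listₚ.++-identityʳ program)) length-program)
             (randomness (noiseAt s)) (λ _ _ → refl)
             (subst (λ rows → Represents (initial c) rows c₀) (sym (Listₚ.++-identityʳ program)) represents)
             (x + d) (toℕ j) (toℕ<n j) ⟩
      start (flag final (x + d) , reset)
            (at (layout (stored final (x + d)) (output final (x + d)) program)) (toℕ j)
        ≡⟨ cong₂ (λ r O → start (r , reset) (at (layout (stored final (x + d)) O program)) (toℕ j))
             (flag≡ (x + d)) (output≡ (x + d)) ⟩
      blockCell (stored final (x + d)) (toℕ j) ∎
      where
      c₀ = unblock size (blockOf ∘ c)
      s₀ = λ k → unblock size (λ x → lookup (s x) k)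
      eq : ∀ m x j d → m * x + j + m * d ≡ m * (x + d) + j
      eq = solve-∀
      represents : Represents (initial c) program c₀
      represents b i i<m = trans (unblock-pos size (blockOf ∘ c) b i<m) (lookup-blockOf (c b) i<m)

-- Indices in a window

-- A bound on the absolute values of the offsets.
radius : List ℤ → ℕ
radius = List.foldr (λ v n → ∣ v ∣ ℕ.+ n) 0

∣∣≤radius : ∀ {v} vs → v ∈ vs → ∣ v ∣ ℕ.≤ radius vs
∣∣≤radius (v ∷ vs) (here refl) = ℕₚ.m≤m+n ∣ v ∣ (radius vs)
∣∣≤radius (u ∷ vs) (there v∈)  = ℕₚ.≤-trans (∣∣≤radius vs v∈) (ℕₚ.m≤n+m (radius vs) ∣ u ∣)

-- The index of the offset v in a window of radius L. The remainder only ensures that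
-- the index is in range for every v.
index : ∀ L → ℤ → Fin (suc (L ℕ.+ L))
index L v = fromℕ< (ℕ.m%n<n ∣ v + + L ∣ (suc (L ℕ.+ L)))

toℕ-index : ∀ L v → ∣ v ∣ ℕ.≤ L → + toℕ (index L v) ≡ v + + L
toℕ-index L v v≤L = begin
  + toℕ (index L v)
    ≡⟨ cong +_ (toℕ-fromℕ< _) ⟩
  + (∣ v + + L ∣ ℕ.% suc (L ℕ.+ L))
    ≡⟨ cong +_ (ℕ.m≤n⇒m%n≡m (ℕₚ.≤-trans (ℤₚ.∣i+j∣≤∣i∣+∣j∣ v (+ L)) (ℕₚ.+-monoˡ-≤ L v≤L))) ⟩
  + ∣ v + + L ∣
    ≡⟨ ℤₚ.0≤i⇒+∣i∣≡i (nonNeg v v≤L) ⟩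
  v + + L ∎
  where
  nonNeg : ∀ v → ∣ v ∣ ℕ.≤ L → 0ℤ ℤ.≤ v + + L
  nonNeg (+ n)    v≤L = ℤ.+≤+ ℕ.z≤n
  nonNeg -[1+ n ] v≤L rewrite ℤₚ.⊖-≥ v≤L = ℤ.+≤+ ℕ.z≤n

-- Simulation of an arbitrary automaton

trivialRescaling : ∀ (A : CA Q R) c s x → global (rescale A 1 1 0ℤ) c s x ≡
  global A (Vec.head ∘ c) (Vec.head ∘ Vec.head ∘ s) x ∷ []
trivialRescaling A c s x = trans (rescale-isRescaling A 1 1 0ℤ c s x) (cong (_∷ [])
  (global-local A (unblock 1 c) (Vec.head ∘ c)
    (unblock 1 (λ x → lookup (s x) Fin.zero)) (Vec.head ∘ Vec.head ∘ s) (+ 1 * x + + 0 + 0ℤ) x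
    (λ {v} _ → at-block c v)
    (λ {v} _ → trans (at-block (λ x → lookup (s x) Fin.zero) v) (cong Vec.head (lookup-zero (s (x + v)))))))
  where
  lookup-zero : ∀ {X : Set} {n} (xs : Vec X (suc n)) → lookup xs Fin.zero ≡ Vec.head xs
  lookup-zero (x ∷ xs) = refl
  eq : ∀ x v → 1ℤ * x + 0ℤ + 0ℤ + v ≡ 1ℤ * (x + v) + 0ℤ
  eq = solve-∀
  at-block : ∀ {X : Set} (d : Conf (Vec X 1)) v →
             unblock 1 d (+ 1 * x + + 0 + 0ℤ + v) ≡ Vec.head (d (x + v))
  at-block d v = trans (cong (unblock 1 d) (eq x v))
    (trans (unblock-pos 1 d (x + v) ℕ.z<s) (lookup-zero (d (x + v))))

module Simulation {Q R : Set} (A : CA Q R) where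

  -- A random symbol takes a bits and a state takes b bits. One bit more than needed
  -- for the random symbols makes a + b a successor by definition.
  private
    a = suc (proj₁ (R-finite A))
    b = proj₁ (Q-finite A)

  code : Q → Vec Bool b
  code = oneHot ∘ Inverse.to (proj₂ (Q-finite A))

  code-injective : Injective _≡_ _≡_ code
  code-injective {x} {y} eq = trans (sym (Inverse.strictlyInverseʳ iso x))
    (trans (cong (Inverse.from iso) (oneHot-injective eq)) (Inverse.strictlyInverseʳ iso y))
    where iso = proj₂ (Q-finite A)

  -- The first bit is not used. As the bits drawn are arbitrary, every vector of bits
  -- has to stand for some random symbol.
  symbol : Vec Bool a → R
  symbol (_ ∷ bits) = firstTrue (R-nonempty A) (Inverse.from (proj₂ (R-finite A))) bits

  bitsFor : R → Vec Bool a
  bitsFor x = false ∷ oneHot (Inverse.to (proj₂ (R-finite A)) x)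

  symbol-bitsFor : ∀ x → symbol (bitsFor x) ≡ x
  symbol-bitsFor x = trans (firstTrue-oneHot _ _ (Inverse.to iso x)) (Inverse.strictlyInverseʳ iso x)
    where iso = proj₂ (R-finite A)

  -- The random bits drawn by a block, and its state.
  Local : Set
  Local = Vec Bool a × Q

  encode : Local → Vec Bool (a ℕ.+ b)
  encode (bits , q) = bits Vec.++ code q

  encode-injective : Injective _≡_ _≡_ encode
  encode-injective {bits , q} {bits′ , q′} eq with e , e′ ← Vecₚ.++-injective bits bits′ eq =
    cong₂ _,_ e (code-injective e′)

  -- The bits stored at rest, before random bits are drawn.
  stateCode : Q → Vec Bool (a ℕ.+ b)
  stateCode q = encode (Vec.replicate a false , q)

  L width : ℕ
  L = radius (V A List.++ V′ A)
  width = suc (L ℕ.+ L)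

  -- The new state of the cell at the centre of a window.
  evaluate : Vec Local width → Q
  evaluate e = f A (Vec.map (λ v → proj₂ (lookup e (index L v))) (fromList (V A)))
                   (Vec.map (λ v → symbol (proj₁ (lookup e (index L v)))) (fromList (V′ A)))

  evaluate-window : ∀ (y : Conf Local) x →
    evaluate (window y (x + - + L) width) ≡ global A (proj₂ ∘ y) (symbol ∘ proj₁ ∘ y) x
  evaluate-window y x = cong₂ (f A)
    (map-fromList-cong (V A) (λ v∈ → cong proj₂ (cell (∈-++⁺ˡ v∈))))
    (map-fromList-cong (V′ A) (λ v∈ → cong (symbol ∘ proj₁) (cell (∈-++⁺ʳ (V A) v∈))))
    where
    eq : ∀ x L v → x + - L + (v + L) ≡ x + v
    eq = solve-∀
    cell : ∀ {v} → v ∈ V A List.++ V′ A →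
           lookup (window y (x + - + L) width) (index L v) ≡ y (x + v)
    cell {v} v∈ = begin
      lookup (window y (x + - + L) width) (index L v)
        ≡⟨ lookup-window y (x + - + L) (index L v) ⟩
      y (x + - + L + + toℕ (index L v))
        ≡⟨ cong (λ u → y (x + - + L + u)) (toℕ-index L v (∣∣≤radius (V A List.++ V′ A) v∈)) ⟩
      y (x + - + L + (v + + L))
        ≡⟨ cong y (eq x (+ L) v) ⟩
      y (x + v) ∎

  Local-finite : Finite Local
  Local-finite = Finite-× (Finite-Vec Finite-Bool a) (Q-finite A)

  -- All windows, in an order that does not matter.
  abstract
    windows : List (Vec Local width)
    windows = elements (Finite-Vec Local-finite width)

    ∈-windows : ∀ e → e ∈ windows
    ∈-windows = ∈-elements (Finite-Vec Local-finite width)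

  entries : List (Row (a ℕ.+ b))
  entries = table encode (stateCode ∘ evaluate) windows

  run-entries : ∀ y ρ {M} → Ready (encode ∘ y) M → Ready (encode ∘ y) (runM entries ρ M) ×
    (∀ x → output (runM entries ρ M) (x + + width) ≡ stateCode (evaluate (window y x width)))
  run-entries y ρ ready = proj₁ ran , λ x → proj₂ ran x (inj₂ (∈-windows (window y x width)))
    where ran = run-table encode encode-injective (stateCode ∘ evaluate) y windows ρ ready

  program : List (Row (a ℕ.+ b))
  program = sampleRow a b ∷ entries List.++ commitRow ∷ []

  module _ (c : Conf Q) (ρ : ℕ → ℤ → Vec Bool (a ℕ.+ b)) where

    private
      bits : ℤ → Vec Bool a
      bits x = Vec.take a (ρ 0 x)
      y : Conf Local
      y x = bits x , c x
      M₁ M₂ M₃ : Macro (a ℕ.+ b)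
      M₁ = stepM (sampleRow a b) (ρ 0) (initial (stateCode ∘ c))
      M₂ = runM entries (ρ ∘ suc) M₁
      M₃ = stepM commitRow (ρ (suc (length entries ℕ.+ 0))) M₂

      ready₁ : Ready (encode ∘ y) M₁
      ready₁ = record
        { flag-true = λ x → rowR-sample a b (stateCode (c (x + -1ℤ)))
        ; stored-≡  = λ x → rowS-sample a b (ρ 0 x) (Vec.replicate _ false)
                              (Vec.replicate a false) (code (c x))
        }

      ran = run-entries y (ρ ∘ suc) ready₁

      final-≡ : runM program ρ (initial (stateCode ∘ c)) ≡ M₃
      final-≡ = runM-++ entries (commitRow ∷ []) (ρ ∘ suc) M₁

      eq : ∀ x L → x + (1ℤ + L) ≡ x + - L + (1ℤ + (L + L))
      eq = solve-∀

    final-flag : ∀ x → flag (runM program ρ (initial (stateCode ∘ c))) x ≡ true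
    final-flag x = trans (cong (λ M → flag M x) final-≡)
      (trans (rowR-commit (stored M₂ (x + -1ℤ)) (flag M₂ (x + -1ℤ)))
             (Ready.flag-true (proj₁ ran) (x + -1ℤ)))

    final-output : ∀ x → output (runM program ρ (initial (stateCode ∘ c))) x ≡ Vec.replicate _ false
    final-output x = trans (cong (λ M → output M x) final-≡)
      (rowO-commit (stored M₂ x) (output M₂ x) (flag M₂ x))

    -- The window of x starts at x - L and ends before x + L + 1, where its entry outputs.
    final-stored : ∀ x → stored (runM program ρ (initial (stateCode ∘ c))) (x + + suc L) ≡
                         stateCode (global A c (λ x → symbol (Vec.take a (ρ 0 x))) x)
    final-stored x = begin
      stored (runM program ρ (initial (stateCode ∘ c))) (x + + suc L)
        ≡⟨ cong (λ M → stored M (x + + suc L)) final-≡ ⟩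
      rowS commitRow _ (stored M₂ (x + + suc L)) (output M₂ (x + + suc L))
        ≡⟨ rowS-commit _ (stored M₂ (x + + suc L)) _ ⟩
      output M₂ (x + + suc L)
        ≡⟨ cong (output M₂) (eq x (+ L)) ⟩
      output M₂ (x + - + L + + width)
        ≡⟨ proj₂ ran (x + - + L) ⟩
      stateCode (evaluate (window y (x + - + L) width))
        ≡⟨ cong stateCode (evaluate-window y x) ⟩
      stateCode (global A c (λ x → symbol (bits x)) x) ∎

  g k : ℕ
  g = length entries
  k = proj₁ (R-finite A) ℕ.+ b

  length-program : length program ≡ 2 ℕ.+ g
  length-program = cong suc (trans (Listₚ.length-++ entries) (ℕₚ.+-comm g 1))

  open Execution k g using (G; size)
  open Blocks k g program length-program hiding (blockOf-injective)

  blockState : Q → Vec Cell size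
  blockState = blockOf ∘ stateCode

  blockState-injective : Injective _≡_ _≡_ blockState
  blockState-injective eq = code-injective
    (Vecₚ.++-injectiveʳ (Vec.replicate a false) (Vec.replicate a false)
      (Blocks.blockOf-injective k g program length-program eq))

  size≤time : size ℕ.≤ time
  size≤time = ℕₚ.m≤m+n size _

  -- The random symbols of the rescaled universal automaton.
  Noise : Set
  Noise = Vec (Vec Bool size) time

  -- The random bits drawn by a block in the first sweep.
  noiseBits : Noise → Vec Bool a
  noiseBits w = Vec.take a (samples G (suc k) (diagonal w))

  noiseFor : R → Noise
  noiseFor x = Vec.replicate time (spread (suc g) (bitsFor x Vec.++ Vec.replicate b false))

  noiseBits-noiseFor : ∀ x → noiseBits (noiseFor x) ≡ bitsFor x
  noiseBits-noiseFor x =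
    trans (cong (Vec.take a) (samples-diagonal (suc g) (bitsFor x Vec.++ Vec.replicate b false) size≤time))
          (take-++ (bitsFor x) _)

  shiftBy : ℤ
  shiftBy = + size * + suc L

  simulates : ∀ c s x → rescaledGlobal universal size time shiftBy (blockState ∘ c) s x ≡
                        blockState (global A c (symbol ∘ noiseBits ∘ s) x)
  simulates c s x = trans
    (run-blocks (stateCode ∘ c) s (final-flag c ρ) (final-output c ρ) (+ suc L) x)
    (cong blockOf (trans (final-stored c ρ x)
      (cong stateCode (global-cong A {c} (λ _ → refl)
        (λ x → cong (symbol ∘ Vec.take a) (randomness-noiseAt k g s x)) x))))
    where
    ρ : ℕ → ℤ → Vec Bool (suc k)
    ρ = Execution.randomness k g (noiseAt s)

  B₁ : CA (Vec Q 1) (Vec (Vec R 1) 1)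
  B₁ = rescale A 1 1 0ℤ

  B₂ : CA (Vec Cell size) Noise
  B₂ = rescale universal size time shiftBy

  decodeNoise : Noise → Vec (Vec R 1) 1
  decodeNoise w = (symbol (noiseBits w) ∷ []) ∷ []

  -- The rescaled A, driven by the random symbols of the rescaled universal automaton.
  Φ : Conf (Vec Q 1) → Conf Noise → Conf (Vec Q 1)
  Φ c s = global B₁ c (decodeNoise ∘ s)

  Φ-commutes : ∀ c s → blockState ∘ Vec.head ∘ Φ c s ≗ global B₂ (blockState ∘ Vec.head ∘ c) s
  Φ-commutes c s x = begin
    blockState (Vec.head (Φ c s x))
      ≡⟨ cong (blockState ∘ Vec.head) (trivialRescaling A c (decodeNoise ∘ s) x) ⟩
    blockState (global A (Vec.head ∘ c) (symbol ∘ noiseBits ∘ s) x)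
      ≡⟨ simulates (Vec.head ∘ c) s x ⟨
    rescaledGlobal universal size time shiftBy (blockState ∘ Vec.head ∘ c) s x
      ≡⟨ rescale-isRescaling universal size time shiftBy (blockState ∘ Vec.head ∘ c) s x ⟨
    global B₂ (blockState ∘ Vec.head ∘ c) s x ∎

  head-injective : Injective _≡_ _≡_ (Vec.head {A = Q} {n = 0})
  head-injective {x ∷ []} {.x ∷ []} refl = refl

  i-injective : Injective _≡_ _≡_ (blockState ∘ Vec.head {n = 0})
  i-injective = head-injective ∘ blockState-injective

  C : CA (Vec Q 1) Noise
  C = restriction B₂ (Q-finite B₁) Vec.head (blockState ∘ Vec.head) Φ

  -- A random configuration of B₁ gives one of C by noise, and conversely by decodeNoise.
  related : InjectionRelated B₁ B₂
  related = blockState ∘ Vec.head , C ,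
    restriction-isRestriction B₂ (Q-finite B₁) Vec.head (blockState ∘ Vec.head) Φ i-injective Φ-commutes ,
    λ c d → mk⇔
      (λ { (s , eq) → noise ∘ s , λ z → trans (C≗Φ c (noise ∘ s) z)
             (trans (global-cong B₁ {c} (λ _ → refl) (λ x → decodeNoise-noise (s x)) z) (eq z)) })
      (λ { (s , eq) → decodeNoise ∘ s , λ z → trans (sym (C≗Φ c s z)) (eq z) })
    where
    C≗Φ = restriction-global B₂ (Q-finite B₁) Vec.head (blockState ∘ Vec.head) Φ
            i-injective Φ-commutes
    noise : Vec (Vec R 1) 1 → Noise
    noise = noiseFor ∘ Vec.head ∘ Vec.head
    decodeNoise-noise : ∀ w → decodeNoise (noise w) ≡ w
    decodeNoise-noise ((x ∷ []) ∷ []) =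
      cong (λ x → (x ∷ []) ∷ []) (trans (cong symbol (noiseBits-noiseFor x)) (symbol-bitsFor x))

  simulated : record { ca = A } ≼ᵢ record { ca = universal }
  simulated = record
    { m₁ = 1 ; m₂ = size ; t₁ = 1 ; t₂ = time ; z₁ = 0ℤ ; z₂ = shiftBy
    ; B₁ = B₁ ; B₂ = B₂
    ; rescaling₁ = rescale-isRescaling A 1 1 0ℤ
    ; rescaling₂ = rescale-isRescaling universal size time shiftBy
    ; related = related
    }

theorem8p4 : (∃[ U ] Universal _≼ᵢ_ U) × (∃[ U ] Universal _≼ₘ_ U)
theorem8p4 = (U , universality) , (U , λ A → ≼ᵢ⇒≼ₘ (universality A))
  where
  U : StochasticCA
  U = record { ca = universal }
  universality : Universal _≼ᵢ_ U
  universality A = Simulation.simulated (ca A)
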